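{- Let $S$ be an $L$-theory extending $I\Sigma_1$ such that for some $K\in\mathbb{N}$, $S$ proves: for all $a,b,c$, if $a,b,c$ are pairwise coprime and $a+b=c$, then $c < K\,\mathrm{rad}(abc)^{1+1/3}$; and $S$ proves Catalan's conjecture for the definable exponential $x^y$, i.e., the only $x,y,a,b>1$ with $x^a - y^b = 1$ are $x=3$, $a=2$, $y=2$, $b=3$. Then the theory $S + \mathrm{Exp}'$ proves Catalan's conjecture for $e$: whenever $x,y \in B$ and $a,b \in A$ with $x,y,a,b>1$ and $e(x,a) - e(y,b) = 1$, then $x=3$, $a=2$, $y=2$, $b=3$.
   Context: $L = \langle 0,1,+,\cdot,\le\rangle$ and $L^e = \langle 0,1,+,\cdot,e,\le\rangle$ with $e$ a binary (possibly partial) function symbol. $I\Sigma_1$ is Robinson arithmetic plus induction for $\Sigma_1$-formulas; in it the usual exponential $x^y$ is $\Delta_1$-definable and every element has a unique prime factorization. $\mathrm{rad}(a)$ is the product of all primes dividing $a$, each taken once. Presburger arithmetic $\mathrm{Pr}$: $0 \ne z+1$; $x\neq 0 \to \exists z\,(x = z+1)$; $x+z=y+z\to x=y$; $x+0=x$; associativity and commutativity of $+$; $x\le y \leftrightarrow \exists z\,(x+z=y)$; and for each standard $0<n\in\mathbb{N}$, $\exists y\,(ny \le x < n(y+1))$. $\mathrm{Exp}'$ consists of the axioms for an $L^e$-structure $\langle \mathcal{B},e\rangle$: (e0) there is an $L$-substructure $\mathcal{A}$ of $\mathcal{B}$ (universe $A$) satisfying the axioms of $\mathrm{Pr}$ such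 that $e: B\times A\to B$; and for all $x\in B$, $y,z\in A$: (e1) $(x=1\vee y=0)\leftrightarrow e(x,y)=1$; (e2) $x\neq0\to e(x,y)\ne 0$; (e3) $e(x,1)=x$; (e4) $e(x,y+z)=e(x,y)\cdot e(x,z)$. -}

module Defs where

open import Data.Fin using (Fin; zero; suc; _↑ʳ_)
open import Data.List using (List; []; _∷_; map)
open import Data.List.Membership.Propositional using (_∈_)
open import Data.Nat using (ℕ; zero; suc; _+_)
open import Function using (_∘_)
open import Level using (Level)
open import Relation.Unary using (Pred)

private
  variable
    c   : Level
    m n : ℕ

infix  9 _^_ _↑_
infixr 8 _·_
infixl 7 _⊗_
infixl 6 _⊕_
infix  5 _≐_ _≤_ _<_ _∣_
infix  4 ¬_
infixr 3 _∧_
infixr 2 _∨_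
infixr 1 _⇒_
infix  0 _⇔_ _⨾_⊢_ _⊢_

------------------------------------------------------------------------
-- Syntax.  Variables are de Bruijn indices; `Term ℓ n` and `Formula ℓ n`
-- have their free variables among n.
--
-- The partial function symbol e is rendered by a total one together with
-- a predicate symbol A, where e(x,y) is regarded as defined iff A(y).
-- Values of e outside its domain are arbitrary: every axiom mentioning
-- e(x,y), and the conclusion, is guarded by A(y).  Since A is otherwise
-- fresh, it also names the substructure whose existence (e0) asserts.

data Lang : Set where
  L Lᵉ : Lang

private
  variable
    ℓ : Lang

data Term : Lang → ℕ → Set where
  var     : Fin n → Term ℓ n
  𝟎 𝟏     : Term ℓ n
  _⊕_ _⊗_ : Term ℓ n → Term ℓ n → Term ℓ n
  e       : Term Lᵉ n → Term Lᵉ n → Term Lᵉ n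

data Formula : Lang → ℕ → Set where
  _≐_ _≤_ : Term ℓ n → Term ℓ n → Formula ℓ n
  A       : Term Lᵉ n → Formula Lᵉ n
  ⊥       : Formula ℓ n
  _⇒_     : Formula ℓ n → Formula ℓ n → Formula ℓ n
  ∀'_     : Formula ℓ (suc n) → Formula ℓ n

Sentence : Lang → Set
Sentence ℓ = Formula ℓ 0

Theory : Lang → (c : Level) → Set (Level.suc c)
Theory ℓ c = Pred (Sentence ℓ) c

-- The logic is classical, so the other connectives are abbreviations.

¬_ : Formula ℓ n → Formula ℓ n
¬ φ = φ ⇒ ⊥

_∧_ _∨_ _⇔_ : Formula ℓ n → Formula ℓ n → Formula ℓ n
φ ∧ ψ = ¬ (φ ⇒ ¬ ψ)
φ ∨ ψ = ¬ φ ⇒ ψ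
φ ⇔ ψ = (φ ⇒ ψ) ∧ (ψ ⇒ φ)

∃'_ : Formula ℓ (suc n) → Formula ℓ n
∃' φ = ¬ (∀' (¬ φ))

------------------------------------------------------------------------
-- Renaming and substitution

renᵗ : (Fin m → Fin n) → Term ℓ m → Term ℓ n
renᵗ ρ (var i) = var (ρ i)
renᵗ ρ 𝟎       = 𝟎
renᵗ ρ 𝟏       = 𝟏
renᵗ ρ (s ⊕ t) = renᵗ ρ s ⊕ renᵗ ρ t
renᵗ ρ (s ⊗ t) = renᵗ ρ s ⊗ renᵗ ρ t
renᵗ ρ (e s t) = e (renᵗ ρ s) (renᵗ ρ t)

_↑_ : Term ℓ n → (k : ℕ) → Term ℓ (k + n)
t ↑ k = renᵗ (k ↑ʳ_) t

subᵗ : (Fin m → Term ℓ n) → Term ℓ m → Term ℓ n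
subᵗ σ (var i) = σ i
subᵗ σ 𝟎       = 𝟎
subᵗ σ 𝟏       = 𝟏
subᵗ σ (s ⊕ t) = subᵗ σ s ⊕ subᵗ σ t
subᵗ σ (s ⊗ t) = subᵗ σ s ⊗ subᵗ σ t
subᵗ σ (e s t) = e (subᵗ σ s) (subᵗ σ t)

under : (Fin m → Term ℓ n) → Fin (suc m) → Term ℓ (suc n)
under σ zero    = var zero
under σ (suc i) = σ i ↑ 1

sub : (Fin m → Term ℓ n) → Formula ℓ m → Formula ℓ n
sub σ (s ≐ t) = subᵗ σ s ≐ subᵗ σ t
sub σ (s ≤ t) = subᵗ σ s ≤ subᵗ σ t
sub σ (A t)   = A (subᵗ σ t)
sub σ ⊥       = ⊥
sub σ (φ ⇒ ψ) = sub σ φ ⇒ sub σ ψ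
sub σ (∀' φ)  = ∀' (sub (under σ) φ)

weaken : Formula ℓ n → Formula ℓ (suc n)
weaken = sub (var ∘ suc)

weakenₛ : Sentence ℓ → Formula ℓ n
weakenₛ = sub λ ()

inst : Term ℓ n → Fin (suc n) → Term ℓ n
inst t zero    = t
inst t (suc i) = var i

_[_] : Formula ℓ (suc n) → Term ℓ n → Formula ℓ n
φ [ t ] = sub (inst t) φ

-- φ(x₀ + 1)
_[x₀+1] : Formula ℓ (suc n) → Formula ℓ (suc n)
φ [x₀+1] = sub σ φ
  where
  σ : Fin (suc n) → Term ℓ (suc n)
  σ zero    = var zero ⊕ 𝟏
  σ (suc i) = var (suc i)

∀* : (n : ℕ) → Formula ℓ n → Sentence ℓ
∀* zero    φ = φ
∀* (suc n) φ = ∀* n (∀' φ)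

------------------------------------------------------------------------
-- Classical natural deduction with equality

data _⨾_⊢_ (T : Theory ℓ c) : List (Formula ℓ n) → Formula ℓ n → Set c where
  ax  : ∀ {Γ : List (Formula ℓ n)} {σ} → T σ → T ⨾ Γ ⊢ weakenₛ σ
  hyp : ∀ {Γ : List (Formula ℓ n)} {φ} → φ ∈ Γ → T ⨾ Γ ⊢ φ
  ⇒I  : ∀ {Γ : List (Formula ℓ n)} {φ ψ} → T ⨾ φ ∷ Γ ⊢ ψ → T ⨾ Γ ⊢ φ ⇒ ψ
  ⇒E  : ∀ {Γ : List (Formula ℓ n)} {φ ψ} → T ⨾ Γ ⊢ φ ⇒ ψ → T ⨾ Γ ⊢ φ → T ⨾ Γ ⊢ ψ
  raa : ∀ {Γ : List (Formula ℓ n)} {φ} → T ⨾ (¬ φ) ∷ Γ ⊢ ⊥ → T ⨾ Γ ⊢ φ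
  ∀I  : ∀ {Γ : List (Formula ℓ n)} {φ} → T ⨾ map weaken Γ ⊢ φ → T ⨾ Γ ⊢ ∀' φ
  ∀E  : ∀ {Γ : List (Formula ℓ n)} {φ} → T ⨾ Γ ⊢ ∀' φ → (t : Term ℓ n) → T ⨾ Γ ⊢ φ [ t ]
  ≐I  : ∀ {Γ : List (Formula ℓ n)} (t : Term ℓ n) → T ⨾ Γ ⊢ t ≐ t
  ≐E  : ∀ {Γ : List (Formula ℓ n)} {s t} (φ : Formula ℓ (suc n)) →
        T ⨾ Γ ⊢ s ≐ t → T ⨾ Γ ⊢ φ [ s ] → T ⨾ Γ ⊢ φ [ t ]

_⊢_ : Theory ℓ c → Sentence ℓ → Set c
T ⊢ φ = T ⨾ [] ⊢ φ

------------------------------------------------------------------------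
-- Arithmetical notions

x₀ : Term ℓ (1 + n)
x₀ = var zero

x₁ : Term ℓ (2 + n)
x₁ = var (suc zero)

x₂ : Term ℓ (3 + n)
x₂ = var (suc (suc zero))

x₃ : Term ℓ (4 + n)
x₃ = var (suc (suc (suc zero)))

x₄ : Term ℓ (5 + n)
x₄ = var (suc (suc (suc (suc zero))))

_<_ : Term ℓ n → Term ℓ n → Formula ℓ n
s < t = (s ≤ t) ∧ ¬ (s ≐ t)

-- k · t = t + ⋯ + t  and  t ^ k = t ⋯ t  (k times) for standard k.

_·_ : ℕ → Term ℓ n → Term ℓ n
zero  · t = 𝟎
suc k · t = k · t ⊕ t

_^_ : Term ℓ n → ℕ → Term ℓ n
t ^ zero  = 𝟏
t ^ suc k = t ^ k ⊗ t

numeral : ℕ → Term ℓ n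
numeral k = k · 𝟏

_∣_ : Term ℓ n → Term ℓ n → Formula ℓ n
s ∣ t = ∃' (s ↑ 1 ⊗ x₀ ≐ t ↑ 1)

Coprime : Term ℓ n → Term ℓ n → Formula ℓ n
Coprime s t = ∀' ((x₀ ∣ s ↑ 1) ∧ (x₀ ∣ t ↑ 1) ⇒ x₀ ≐ 𝟏)

Prime : Term ℓ n → Formula ℓ n
Prime p = (𝟏 < p) ∧ (∀' (x₀ ∣ p ↑ 1 ⇒ (x₀ ≐ 𝟏) ∨ (x₀ ≐ p ↑ 1)))

∀≤ ∃≤ ∀< : Term ℓ n → Formula ℓ (suc n) → Formula ℓ n
∀≤ t φ = ∀' (x₀ ≤ t ↑ 1 ⇒ φ)
∃≤ t φ = ∃' ((x₀ ≤ t ↑ 1) ∧ φ)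
∀< t φ = ∀≤ t (¬ (x₀ ≐ t ↑ 1) ⇒ φ)

-- Gödel's β-function: v is the remainder of c modulo 1 + (i + 1) d.
β : (c d i v : Term ℓ n) → Formula ℓ n
β c d i v = (v < q) ∧ ∃≤ c (c ↑ 1 ≐ x₀ ⊗ q ↑ 1 ⊕ v ↑ 1)
  where
  q = 𝟏 ⊕ (i ⊕ 𝟏) ⊗ d

-- z is the last term of a (coded) sequence s₀, …, s_y such that s₀ = 1 and
-- step i sᵢ sᵢ₊₁ holds for all i < y.  Below the quantifiers
-- x₄ = c, x₃ = d (the code), x₂ = i, x₁ = sᵢ, x₀ = sᵢ₊₁.
Iterate : (step : (i v w : Term ℓ (5 + n)) → Formula ℓ (5 + n)) →
          (y z : Term ℓ n) → Formula ℓ n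
Iterate step y z = ∃' ∃'
  (  β x₁ x₀ 𝟎 𝟏
  ∧ ∀< (y ↑ 2) (∃≤ x₂ (∃≤ x₃
      (β x₄ x₃ x₂ x₁ ∧ β x₄ x₃ (x₂ ⊕ 𝟏) x₀ ∧ step x₂ x₁ x₀)))
  ∧ β x₁ x₀ (y ↑ 2) (z ↑ 2))

-- z = x^y
Exp : (x y z : Term ℓ n) → Formula ℓ n
Exp x y z = Iterate (λ i v w → w ≐ v ⊗ x ↑ 5) y z

-- r = rad(x): the product over 1 ≤ p ≤ x of the factor p when p is a prime
-- dividing x, and of the factor 1 otherwise.  (This gives rad(0) = 1.)
Rad : (x r : Term ℓ n) → Formula ℓ n
Rad {ℓ} {n} x r = Iterate step x r
  where
  step : (i v w : Term ℓ (5 + n)) → Formula ℓ (5 + n)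
  step i v w = (P ∧ (w ≐ v ⊗ p)) ∨ (¬ P ∧ (w ≐ v))
    where
    p = i ⊕ 𝟏
    P = Prime p ∧ (p ∣ x ↑ 5)

------------------------------------------------------------------------
-- IΣ₁

data Δ₀ : Formula L n → Set where
  eq   : (s t : Term L n) → Δ₀ (s ≐ t)
  le   : (s t : Term L n) → Δ₀ (s ≤ t)
  bot  : Δ₀ {n} ⊥
  imp  : {φ ψ : Formula L n} → Δ₀ φ → Δ₀ ψ → Δ₀ (φ ⇒ ψ)
  ball : {φ : Formula L (suc n)} (t : Term L n) → Δ₀ φ → Δ₀ (∀≤ t φ)
  bex  : {φ : Formula L (suc n)} (t : Term L n) → Δ₀ φ → Δ₀ (∃≤ t φ)

data Σ₁ : Formula L n → Set where
  Δ₀⇒Σ₁ : {φ : Formula L n} → Δ₀ φ → Σ₁ φ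
  ex    : {φ : Formula L (suc n)} → Σ₁ φ → Σ₁ (∃' φ)

data IΣ₁ : Sentence L → Set where
  suc≢0 : IΣ₁ (∀' (¬ (x₀ ⊕ 𝟏 ≐ 𝟎)))
  suc-injective : IΣ₁ (∀' ∀' (x₁ ⊕ 𝟏 ≐ x₀ ⊕ 𝟏 ⇒ x₁ ≐ x₀))
  0-or-suc : IΣ₁ (∀' (¬ (x₀ ≐ 𝟎) ⇒ ∃' (x₁ ≐ x₀ ⊕ 𝟏)))
  +-zero : IΣ₁ (∀' (x₀ ⊕ 𝟎 ≐ x₀))
  +-suc : IΣ₁ (∀' ∀' (x₁ ⊕ (x₀ ⊕ 𝟏) ≐ (x₁ ⊕ x₀) ⊕ 𝟏))
  *-zero : IΣ₁ (∀' (x₀ ⊗ 𝟎 ≐ 𝟎))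
  *-suc : IΣ₁ (∀' ∀' (x₁ ⊗ (x₀ ⊕ 𝟏) ≐ x₁ ⊗ x₀ ⊕ x₁))
  ≤-def : IΣ₁ (∀' ∀' (x₁ ≤ x₀ ⇔ ∃' (x₀ ⊕ x₂ ≐ x₁)))
  induction : {φ : Formula L (suc n)} → Σ₁ φ →
    IΣ₁ (∀* n (φ [ 𝟎 ] ∧ (∀' (φ ⇒ φ [x₀+1])) ⇒ ∀' φ))

------------------------------------------------------------------------
-- Presburger arithmetic

data Pr : Sentence L → Set where
  0≢suc : Pr (∀' (¬ (𝟎 ≐ x₀ ⊕ 𝟏)))
  0-or-suc : Pr (∀' (¬ (x₀ ≐ 𝟎) ⇒ ∃' (x₁ ≐ x₀ ⊕ 𝟏)))
  +-cancel : Pr (∀' ∀' ∀' (x₂ ⊕ x₀ ≐ x₁ ⊕ x₀ ⇒ x₂ ≐ x₁))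
  +-zero : Pr (∀' (x₀ ⊕ 𝟎 ≐ x₀))
  +-assoc : Pr (∀' ∀' ∀' ((x₂ ⊕ x₁) ⊕ x₀ ≐ x₂ ⊕ (x₁ ⊕ x₀)))
  +-comm : Pr (∀' ∀' (x₁ ⊕ x₀ ≐ x₀ ⊕ x₁))
  ≤-def : Pr (∀' ∀' (x₁ ≤ x₀ ⇔ ∃' (x₂ ⊕ x₀ ≐ x₁)))
  division : (k : ℕ) →
    Pr (∀' ∃' ((suc k · x₀ ≤ x₁) ∧ (x₁ < suc k · (x₀ ⊕ 𝟏))))

------------------------------------------------------------------------
-- Exp′

liftᵗ : Term L n → Term Lᵉ n
liftᵗ (var i) = var i
liftᵗ 𝟎       = 𝟎
liftᵗ 𝟏       = 𝟏
liftᵗ (s ⊕ t) = liftᵗ s ⊕ liftᵗ t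
liftᵗ (s ⊗ t) = liftᵗ s ⊗ liftᵗ t

lift : Formula L n → Formula Lᵉ n
lift (s ≐ t) = liftᵗ s ≐ liftᵗ t
lift (s ≤ t) = liftᵗ s ≤ liftᵗ t
lift ⊥       = ⊥
lift (φ ⇒ ψ) = lift φ ⇒ lift ψ
lift (∀' φ)  = ∀' (lift φ)

-- "φ holds in the substructure A": quantifiers are relativized to A.
_ᴬ : Formula L n → Formula Lᵉ n
(s ≐ t) ᴬ = liftᵗ s ≐ liftᵗ t
(s ≤ t) ᴬ = liftᵗ s ≤ liftᵗ t
⊥       ᴬ = ⊥
(φ ⇒ ψ) ᴬ = φ ᴬ ⇒ ψ ᴬ
(∀' φ)  ᴬ = ∀' (A x₀ ⇒ φ ᴬ)

data Exp′ : Sentence Lᵉ → Set where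
  A-zero : Exp′ (A 𝟎)
  A-one  : Exp′ (A 𝟏)
  A-+    : Exp′ (∀' ∀' (A x₁ ⇒ A x₀ ⇒ A (x₁ ⊕ x₀)))
  A-*    : Exp′ (∀' ∀' (A x₁ ⇒ A x₀ ⇒ A (x₁ ⊗ x₀)))
  A-Pr   : ∀ {φ} → Pr φ → Exp′ (φ ᴬ)
  e1 : Exp′ (∀' ∀' (A x₀ ⇒ ((x₁ ≐ 𝟏) ∨ (x₀ ≐ 𝟎) ⇔ e x₁ x₀ ≐ 𝟏)))
  e2 : Exp′ (∀' ∀' (A x₀ ⇒ ¬ (x₁ ≐ 𝟎) ⇒ ¬ (e x₁ x₀ ≐ 𝟎)))
  e3 : Exp′ (∀' (e x₀ 𝟏 ≐ x₀))
  e4 : Exp′ (∀' ∀' ∀' (A x₁ ⇒ A x₀ ⇒ e x₂ (x₁ ⊕ x₀) ≐ e x₂ x₁ ⊗ e x₂ x₀))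

data _+Exp′ (S : Theory L c) : Theory Lᵉ c where
  theory : ∀ {φ} → S φ → (S +Exp′) (lift φ)
  exp′   : ∀ {φ} → Exp′ φ → (S +Exp′) φ

_Extends_ : ∀ {c d} → Theory ℓ c → Theory ℓ d → Set (c Level.⊔ d)
S Extends T = ∀ {φ} → T φ → S ⊢ φ

------------------------------------------------------------------------
-- The number-theoretic sentences

-- c < K rad(abc)^(1+1/3) is stated as c³ < K³ rad(abc)⁴.
-- Variables: x₂ = a, x₁ = b, x₀ = c; below ∃' they are x₃, x₂, x₁ and
-- x₀ = rad(abc).
abc : ℕ → Sentence L
abc K = ∀' ∀' ∀'
  ( Coprime x₂ x₁ ∧ Coprime x₂ x₀ ∧ Coprime x₁ x₀ ⇒ x₂ ⊕ x₁ ≐ x₀ ⇒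
    ∃' (Rad (x₃ ⊗ x₂ ⊗ x₁) x₀ ∧ (x₁ ^ 3 < numeral K ^ 3 ⊗ x₀ ^ 4)))

OnlySolution : (x y a b : Term ℓ n) → Formula ℓ n
OnlySolution x y a b =
  (x ≐ numeral 3) ∧ (a ≐ numeral 2) ∧ (y ≐ numeral 2) ∧ (b ≐ numeral 3)

-- In both versions of Catalan's conjecture the variables are
-- x₃ = x, x₂ = y, x₁ = a, x₀ = b, and u - v = 1 is stated as u = v + 1.

-- Below the two ∃' the variables are shifted by 2, x₁ = x^a and x₀ = y^b.
Catalan : Sentence L
Catalan = ∀' ∀' ∀' ∀'
  ( (𝟏 < x₃) ∧ (𝟏 < x₂) ∧ (𝟏 < x₁) ∧ (𝟏 < x₀) ⇒
    ∃' ∃' (Exp (x₃ ↑ 2) (x₁ ↑ 2) x₁ ∧ Exp (x₂ ↑ 2) (x₀ ↑ 2) x₀ ∧ (x₁ ≐ x₀ ⊕ 𝟏)) ⇒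
    OnlySolution x₃ x₂ x₁ x₀)

Catalanᵉ : Sentence Lᵉ
Catalanᵉ = ∀' ∀' ∀' ∀'
  ( A x₁ ∧ A x₀ ⇒
    (𝟏 < x₃) ∧ (𝟏 < x₂) ∧ (𝟏 < x₁) ∧ (𝟏 < x₀) ⇒
    e x₃ x₁ ≐ e x₂ x₀ ⊕ 𝟏 ⇒
    OnlySolution x₃ x₂ x₁ x₀)

{-# OPTIONS --safe #-}

-- Write X = e(x,a) = e(y,b) + 1 = Y + 1.  If a ∈ A is large, divide it by 2 three times in
-- Presburger arithmetic: a ≈ 8 q gives v = e(x,q) with v⁸ ≤ X such that every prime dividing X
-- divides v; for a ≥ 2 one division gives u with u² ≤ X.  So if one exponent exceeds a suitable
-- standard bound, then rad(XY) ≤ u v and abc yields X³ < K³ u⁴ v⁴ ≤ K³ X² v⁴, that is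
-- X < K³ v⁴, whence X < K⁶, which is false for a large exponent.  Otherwise a and b are
-- standard, e is ordinary exponentiation, and Catalan's conjecture in S applies.
module Submission where

open import Defs
open import Data.Bool using (Bool; true; false; if_then_else_)
open import Data.Fin using (Fin; zero; suc; toℕ)
open import Data.List using (List; []; _∷_; map; foldr)
open import Data.List.Membership.Propositional.Properties using (∈-map⁺)
open import Data.List.Properties using (map-∘; map-cong)
open import Data.List.Relation.Binary.Subset.Propositional using (_⊆_)
open import Data.List.Relation.Binary.Subset.Propositional.Properties using (map⁺; xs⊆x∷xs; ∷⁺ʳ)
open import Data.List.Relation.Unary.Any using (here; there)
open import Data.Nat using (ℕ; zero; suc; _+_; _*_; _<ᵇ_)
open import Data.Product using (∃; _,_)
open import Data.Vec using (Vec; []; _∷_; lookup)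
open import Function using (_∘_)
open import Level using (Level)
open import Relation.Binary.PropositionalEquality using (_≡_; refl; sym; trans; cong; cong₂; subst)

-- The margin forces the unequal roots. Only one exponent can be assumed large and the other may be
-- 2, so its power guarantees no more than a factor u with u² ≤ X, and u⁴ may consume X² of the
-- available X³. The bound on v⁴ must then fall short of X by more than the constant K³: a fourth
-- root would leave nothing, an eighth root leaves √X. Halving an odd exponent loses one factor of
-- the base, which the root still contains; this is why the primes survive.
--
-- The axioms give no induction for formulas containing `e`, and standardness is not expressible.
-- The split into small and large exponents is therefore proved for each numeral by a recursion
-- outside the theory. Even when the exponent is standard the base need not be, so identifying
-- e(x,a) with the definable power requires building a β-code inside IΣ₁.

private
  variable
    c c′ : Level
    k m n : ℕ
    ℓ : Lang
    T : Theory ℓ c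
    T′ : Theory ℓ c′
    Γ : List (Formula ℓ n)
    φ ψ χ : Formula ℓ n
    s t u v s′ t′ : Term ℓ n

-- Substitution

subᵗ-cong : ∀ {σ τ : Fin m → Term ℓ n} → (∀ i → σ i ≡ τ i) → ∀ t → subᵗ σ t ≡ subᵗ τ t
subᵗ-cong σ≗τ (var i) = σ≗τ i
subᵗ-cong σ≗τ 𝟎       = refl
subᵗ-cong σ≗τ 𝟏       = refl
subᵗ-cong σ≗τ (s ⊕ t) = cong₂ _⊕_ (subᵗ-cong σ≗τ s) (subᵗ-cong σ≗τ t)
subᵗ-cong σ≗τ (s ⊗ t) = cong₂ _⊗_ (subᵗ-cong σ≗τ s) (subᵗ-cong σ≗τ t)
subᵗ-cong σ≗τ (e s t) = cong₂ e (subᵗ-cong σ≗τ s) (subᵗ-cong σ≗τ t)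

under-cong : ∀ {σ τ : Fin m → Term ℓ n} → (∀ i → σ i ≡ τ i) → ∀ i → under σ i ≡ under τ i
under-cong σ≗τ zero    = refl
under-cong σ≗τ (suc i) = cong (_↑ 1) (σ≗τ i)

sub-cong : ∀ {σ τ : Fin m → Term ℓ n} → (∀ i → σ i ≡ τ i) → ∀ φ → sub σ φ ≡ sub τ φ
sub-cong σ≗τ (s ≐ t) = cong₂ _≐_ (subᵗ-cong σ≗τ s) (subᵗ-cong σ≗τ t)
sub-cong σ≗τ (s ≤ t) = cong₂ _≤_ (subᵗ-cong σ≗τ s) (subᵗ-cong σ≗τ t)
sub-cong σ≗τ (A t)   = cong A (subᵗ-cong σ≗τ t)
sub-cong σ≗τ ⊥       = refl
sub-cong σ≗τ (φ ⇒ ψ) = cong₂ _⇒_ (sub-cong σ≗τ φ) (sub-cong σ≗τ ψ)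
sub-cong σ≗τ (∀' φ)  = cong ∀'_ (sub-cong (under-cong σ≗τ) φ)

subᵗ-renᵗ : ∀ (σ : Fin m → Term ℓ n) (ρ : Fin k → Fin m) t → subᵗ σ (renᵗ ρ t) ≡ subᵗ (σ ∘ ρ) t
subᵗ-renᵗ σ ρ (var i) = refl
subᵗ-renᵗ σ ρ 𝟎       = refl
subᵗ-renᵗ σ ρ 𝟏       = refl
subᵗ-renᵗ σ ρ (s ⊕ t) = cong₂ _⊕_ (subᵗ-renᵗ σ ρ s) (subᵗ-renᵗ σ ρ t)
subᵗ-renᵗ σ ρ (s ⊗ t) = cong₂ _⊗_ (subᵗ-renᵗ σ ρ s) (subᵗ-renᵗ σ ρ t)
subᵗ-renᵗ σ ρ (e s t) = cong₂ e (subᵗ-renᵗ σ ρ s) (subᵗ-renᵗ σ ρ t)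

renᵗ-subᵗ : ∀ (ρ : Fin m → Fin n) (σ : Fin k → Term ℓ m) t →
            renᵗ ρ (subᵗ σ t) ≡ subᵗ (renᵗ ρ ∘ σ) t
renᵗ-subᵗ ρ σ (var i) = refl
renᵗ-subᵗ ρ σ 𝟎       = refl
renᵗ-subᵗ ρ σ 𝟏       = refl
renᵗ-subᵗ ρ σ (s ⊕ t) = cong₂ _⊕_ (renᵗ-subᵗ ρ σ s) (renᵗ-subᵗ ρ σ t)
renᵗ-subᵗ ρ σ (s ⊗ t) = cong₂ _⊗_ (renᵗ-subᵗ ρ σ s) (renᵗ-subᵗ ρ σ t)
renᵗ-subᵗ ρ σ (e s t) = cong₂ e (renᵗ-subᵗ ρ σ s) (renᵗ-subᵗ ρ σ t)

subᵗ-∘ : ∀ (τ : Fin m → Term ℓ n) (σ : Fin k → Term ℓ m) t →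
         subᵗ τ (subᵗ σ t) ≡ subᵗ (subᵗ τ ∘ σ) t
subᵗ-∘ τ σ (var i) = refl
subᵗ-∘ τ σ 𝟎       = refl
subᵗ-∘ τ σ 𝟏       = refl
subᵗ-∘ τ σ (s ⊕ t) = cong₂ _⊕_ (subᵗ-∘ τ σ s) (subᵗ-∘ τ σ t)
subᵗ-∘ τ σ (s ⊗ t) = cong₂ _⊗_ (subᵗ-∘ τ σ s) (subᵗ-∘ τ σ t)
subᵗ-∘ τ σ (e s t) = cong₂ e (subᵗ-∘ τ σ s) (subᵗ-∘ τ σ t)

under-∘ : ∀ (τ : Fin m → Term ℓ n) (σ : Fin k → Term ℓ m) i →
          subᵗ (under τ) (under σ i) ≡ under (subᵗ τ ∘ σ) i
under-∘ τ σ zero    = refl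
under-∘ τ σ (suc i) = trans (subᵗ-renᵗ (under τ) suc (σ i)) (sym (renᵗ-subᵗ suc τ (σ i)))

sub-∘ : ∀ (τ : Fin m → Term ℓ n) (σ : Fin k → Term ℓ m) φ →
        sub τ (sub σ φ) ≡ sub (subᵗ τ ∘ σ) φ
sub-∘ τ σ (s ≐ t) = cong₂ _≐_ (subᵗ-∘ τ σ s) (subᵗ-∘ τ σ t)
sub-∘ τ σ (s ≤ t) = cong₂ _≤_ (subᵗ-∘ τ σ s) (subᵗ-∘ τ σ t)
sub-∘ τ σ (A t)   = cong A (subᵗ-∘ τ σ t)
sub-∘ τ σ ⊥       = refl
sub-∘ τ σ (φ ⇒ ψ) = cong₂ _⇒_ (sub-∘ τ σ φ) (sub-∘ τ σ ψ)
sub-∘ τ σ (∀' φ)  = cong ∀'_ (trans (sub-∘ (under τ) (under σ) φ) (sub-cong (under-∘ τ σ) φ))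

subᵗ-var : ∀ {σ : Fin n → Term ℓ n} → (∀ i → σ i ≡ var i) → ∀ t → subᵗ σ t ≡ t
subᵗ-var σ≗τ (var i) = σ≗τ i
subᵗ-var σ≗τ 𝟎       = refl
subᵗ-var σ≗τ 𝟏       = refl
subᵗ-var σ≗τ (s ⊕ t) = cong₂ _⊕_ (subᵗ-var σ≗τ s) (subᵗ-var σ≗τ t)
subᵗ-var σ≗τ (s ⊗ t) = cong₂ _⊗_ (subᵗ-var σ≗τ s) (subᵗ-var σ≗τ t)
subᵗ-var σ≗τ (e s t) = cong₂ e (subᵗ-var σ≗τ s) (subᵗ-var σ≗τ t)

sub-var : ∀ {σ : Fin n → Term ℓ n} → (∀ i → σ i ≡ var i) → ∀ φ → sub σ φ ≡ φ
sub-var σ≗τ (s ≐ t) = cong₂ _≐_ (subᵗ-var σ≗τ s) (subᵗ-var σ≗τ t)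
sub-var σ≗τ (s ≤ t) = cong₂ _≤_ (subᵗ-var σ≗τ s) (subᵗ-var σ≗τ t)
sub-var σ≗τ (A t)   = cong A (subᵗ-var σ≗τ t)
sub-var σ≗τ ⊥       = refl
sub-var σ≗τ (φ ⇒ ψ) = cong₂ _⇒_ (sub-var σ≗τ φ) (sub-var σ≗τ ψ)
sub-var σ≗τ (∀' φ)  = cong ∀'_ (sub-var (λ { zero → refl ; (suc i) → cong (_↑ 1) (σ≗τ i) }) φ)

subᵗ-inst-↑ : ∀ (s t : Term ℓ n) → subᵗ (inst s) (t ↑ 1) ≡ t
subᵗ-inst-↑ s t = trans (subᵗ-renᵗ (inst s) suc t) (subᵗ-var (λ _ → refl) t)

sub-inst-under : ∀ (σ : Fin (suc m) → Term ℓ n) φ →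
                 sub (under (σ ∘ suc)) φ [ σ zero ] ≡ sub σ φ
sub-inst-under σ φ = trans (sub-∘ _ _ φ)
  (sub-cong (λ { zero → refl ; (suc i) → subᵗ-inst-↑ (σ zero) (σ (suc i)) }) φ)

sub-inst : ∀ (σ : Fin m → Term ℓ n) φ t → sub σ (φ [ t ]) ≡ sub (under σ) φ [ subᵗ σ t ]
sub-inst σ φ t = trans (sub-∘ σ (inst t) φ) (trans
  (sub-cong (λ { zero → refl ; (suc i) → sym (subᵗ-inst-↑ (subᵗ σ t) (σ i)) }) φ)
  (sym (sub-∘ (inst (subᵗ σ t)) (under σ) φ)))

sub-weaken : ∀ (σ : Fin m → Term ℓ n) φ → sub (under σ) (weaken φ) ≡ weaken (sub σ φ)
sub-weaken σ φ = trans (sub-∘ _ _ φ) (trans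
  (sub-cong (λ i → ren-sub (σ i)) φ) (sym (sub-∘ _ σ φ)))
  where
  ren-sub : ∀ t → t ↑ 1 ≡ subᵗ (var ∘ suc) t
  ren-sub t = trans (cong (renᵗ suc) (sym (subᵗ-var (λ _ → refl) t))) (renᵗ-subᵗ suc var t)

-- Structural properties of derivations

monotone : ∀ {Γ Δ : List (Formula ℓ n)} {φ} → Γ ⊆ Δ → T ⨾ Γ ⊢ φ → T ⨾ Δ ⊢ φ
monotone Γ⊆Δ (ax a)     = ax a
monotone Γ⊆Δ (hyp i)    = hyp (Γ⊆Δ i)
monotone Γ⊆Δ (⇒I p)     = ⇒I (monotone (∷⁺ʳ _ Γ⊆Δ) p)
monotone Γ⊆Δ (⇒E p q)   = ⇒E (monotone Γ⊆Δ p) (monotone Γ⊆Δ q)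
monotone Γ⊆Δ (raa p)    = raa (monotone (∷⁺ʳ _ Γ⊆Δ) p)
monotone Γ⊆Δ (∀I p)     = ∀I (monotone (map⁺ weaken Γ⊆Δ) p)
monotone Γ⊆Δ (∀E p t)   = ∀E (monotone Γ⊆Δ p) t
monotone Γ⊆Δ (≐I t)     = ≐I t
monotone Γ⊆Δ (≐E φ p q) = ≐E φ (monotone Γ⊆Δ p) (monotone Γ⊆Δ q)

substitute : ∀ {Γ : List (Formula ℓ m)} {φ} (σ : Fin m → Term ℓ n) →
             T ⨾ Γ ⊢ φ → T ⨾ map (sub σ) Γ ⊢ sub σ φ
substitute σ (ax {σ = χ} a) =
  subst (_ ⨾ _ ⊢_) (sym (trans (sub-∘ σ (λ ()) χ) (sub-cong (λ ()) χ))) (ax a)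
substitute σ (hyp i)    = hyp (∈-map⁺ (sub σ) i)
substitute σ (⇒I p)     = ⇒I (substitute σ p)
substitute σ (⇒E p q)   = ⇒E (substitute σ p) (substitute σ q)
substitute σ (raa p)    = raa (substitute σ p)
substitute {Γ = Γ} σ (∀I p) = ∀I (subst (_ ⨾_⊢ _) weaken-context (substitute (under σ) p))
  where
  weaken-context : map (sub (under σ)) (map weaken Γ) ≡ map weaken (map (sub σ) Γ)
  weaken-context = trans (sym (map-∘ Γ)) (trans (map-cong (sub-weaken σ) Γ) (map-∘ Γ))
substitute σ (∀E {φ = φ} p t) =
  subst (_ ⨾ _ ⊢_) (sym (sub-inst σ φ t)) (∀E (substitute σ p) (subᵗ σ t))
substitute σ (≐I t)     = ≐I (subᵗ σ t)
substitute σ (≐E {s = s} {t = t} φ p q) =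
  subst (_ ⨾ _ ⊢_) (sym (sub-inst σ φ t))
    (≐E (sub (under σ) φ) (substitute σ p) (subst (_ ⨾ _ ⊢_) (sub-inst σ φ s) (substitute σ q)))

-- The arithmetic lemmas below are derived about variables in an empty context and then moved to
-- arbitrary terms and hypotheses. For arbitrary terms `inst` cancels a shift only up to
-- propositional equality; for variables it computes.
instantiate : ∀ {Γ : List (Formula ℓ n)} {φ : Formula ℓ m} (σ : Fin m → Term ℓ n) →
              T ⨾ [] ⊢ φ → T ⨾ Γ ⊢ sub σ φ
instantiate σ p = monotone (λ ()) (substitute σ p)

replace-axioms : (∀ {χ} → T χ → T′ ⊢ χ) →
                 ∀ {Γ : List (Formula ℓ n)} {φ} → T ⨾ Γ ⊢ φ → T′ ⨾ Γ ⊢ φ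
replace-axioms f (ax a)     = instantiate (λ ()) (f a)
replace-axioms f (hyp i)    = hyp i
replace-axioms f (⇒I p)     = ⇒I (replace-axioms f p)
replace-axioms f (⇒E p q)   = ⇒E (replace-axioms f p) (replace-axioms f q)
replace-axioms f (raa p)    = raa (replace-axioms f p)
replace-axioms f (∀I p)     = ∀I (replace-axioms f p)
replace-axioms f (∀E p t)   = ∀E (replace-axioms f p) t
replace-axioms f (≐I t)     = ≐I t
replace-axioms f (≐E φ p q) = ≐E φ (replace-axioms f p) (replace-axioms f q)

∀*E : ∀ (m : ℕ) {Γ : List (Formula ℓ n)} {φ : Formula ℓ m} {ρ : Fin 0 → Term ℓ n} →
      T ⨾ Γ ⊢ sub ρ (∀* m φ) → (σ : Fin m → Term ℓ n) → T ⨾ Γ ⊢ sub σ φ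
∀*E zero    {φ = φ} p σ = subst (_ ⨾ _ ⊢_) (sub-cong (λ ()) φ) p
∀*E (suc m) {φ = φ} p σ =
  subst (_ ⨾ _ ⊢_) (sub-inst-under σ φ) (∀E (∀*E m p (σ ∘ suc)) (σ zero))

unclose : ∀ (m : ℕ) {φ : Formula ℓ m} → T ⊢ ∀* m φ → T ⨾ [] ⊢ φ
unclose m {φ} p =
  subst (_ ⨾ _ ⊢_) (sub-var (λ _ → refl) φ) (∀*E m {ρ = λ ()} (instantiate (λ ()) p) var)

axiom : ∀ (m : ℕ) {Γ : List (Formula ℓ n)} {φ : Formula ℓ m} →
        T (∀* m φ) → (ts : Vec (Term ℓ n) m) → T ⨾ Γ ⊢ sub (lookup ts) φ
axiom m a ts = ∀*E m (ax a) (lookup ts)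

-- Lifting from L to Lᵉ

liftᵗ-renᵗ : ∀ (ρ : Fin m → Fin n) t → liftᵗ (renᵗ ρ t) ≡ renᵗ ρ (liftᵗ t)
liftᵗ-renᵗ ρ (var i) = refl
liftᵗ-renᵗ ρ 𝟎       = refl
liftᵗ-renᵗ ρ 𝟏       = refl
liftᵗ-renᵗ ρ (s ⊕ t) = cong₂ _⊕_ (liftᵗ-renᵗ ρ s) (liftᵗ-renᵗ ρ t)
liftᵗ-renᵗ ρ (s ⊗ t) = cong₂ _⊗_ (liftᵗ-renᵗ ρ s) (liftᵗ-renᵗ ρ t)

liftᵗ-subᵗ : ∀ {σ : Fin m → Term L n} {τ} → (∀ i → liftᵗ (σ i) ≡ τ i) →
             ∀ t → liftᵗ (subᵗ σ t) ≡ subᵗ τ (liftᵗ t)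
liftᵗ-subᵗ σ≗τ (var i) = σ≗τ i
liftᵗ-subᵗ σ≗τ 𝟎       = refl
liftᵗ-subᵗ σ≗τ 𝟏       = refl
liftᵗ-subᵗ σ≗τ (s ⊕ t) = cong₂ _⊕_ (liftᵗ-subᵗ σ≗τ s) (liftᵗ-subᵗ σ≗τ t)
liftᵗ-subᵗ σ≗τ (s ⊗ t) = cong₂ _⊗_ (liftᵗ-subᵗ σ≗τ s) (liftᵗ-subᵗ σ≗τ t)

lift-sub : ∀ {σ : Fin m → Term L n} {τ} → (∀ i → liftᵗ (σ i) ≡ τ i) →
           ∀ φ → lift (sub σ φ) ≡ sub τ (lift φ)
lift-sub σ≗τ (s ≐ t) = cong₂ _≐_ (liftᵗ-subᵗ σ≗τ s) (liftᵗ-subᵗ σ≗τ t)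
lift-sub σ≗τ (s ≤ t) = cong₂ _≤_ (liftᵗ-subᵗ σ≗τ s) (liftᵗ-subᵗ σ≗τ t)
lift-sub σ≗τ ⊥       = refl
lift-sub σ≗τ (φ ⇒ ψ) = cong₂ _⇒_ (lift-sub σ≗τ φ) (lift-sub σ≗τ ψ)
lift-sub {σ = σ} σ≗τ (∀' φ) = cong ∀'_
  (lift-sub (λ { zero → refl ; (suc i) → trans (liftᵗ-renᵗ suc (σ i)) (cong (_↑ 1) (σ≗τ i)) }) φ)

lift-inst : ∀ (φ : Formula L (suc n)) t → lift (φ [ t ]) ≡ lift φ [ liftᵗ t ]
lift-inst φ t = lift-sub (λ { zero → refl ; (suc i) → refl }) φ

lift-derivation : ∀ {S : Theory L c} {Γ : List (Formula L n)} {φ} →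
                  S ⨾ Γ ⊢ φ → (S +Exp′) ⨾ map lift Γ ⊢ lift φ
lift-derivation (ax {σ = χ} a) = subst (_ ⨾ _ ⊢_) (sym (lift-sub (λ ()) χ)) (ax (theory a))
lift-derivation (hyp i)    = hyp (∈-map⁺ lift i)
lift-derivation (⇒I p)     = ⇒I (lift-derivation p)
lift-derivation (⇒E p q)   = ⇒E (lift-derivation p) (lift-derivation q)
lift-derivation (raa p)    = raa (lift-derivation p)
lift-derivation {Γ = Γ} (∀I p) = ∀I (subst (_ ⨾_⊢ _) lift-context (lift-derivation p))
  where
  lift-context : map lift (map weaken Γ) ≡ map weaken (map lift Γ)
  lift-context = trans (sym (map-∘ Γ)) (trans (map-cong (lift-sub (λ _ → refl)) Γ) (map-∘ Γ))
lift-derivation (∀E {φ = φ} p t) =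
  subst (_ ⨾ _ ⊢_) (sym (lift-inst φ t)) (∀E (lift-derivation p) (liftᵗ t))
lift-derivation (≐I t)     = ≐I (liftᵗ t)
lift-derivation (≐E {s = s} {t = t} φ p q) =
  subst (_ ⨾ _ ⊢_) (sym (lift-inst φ t))
    (≐E (lift φ) (lift-derivation p) (subst (_ ⨾ _ ⊢_) (lift-inst φ s) (lift-derivation q)))

-- Derived rules

infixl 10 _∙_

_∙_ : T ⨾ Γ ⊢ φ ⇒ ψ → T ⨾ Γ ⊢ φ → T ⨾ Γ ⊢ ψ
_∙_ = ⇒E

pattern i0 = here refl
pattern i1 = there i0
pattern i2 = there i1
pattern i3 = there i2
pattern i4 = there i3
pattern i5 = there i4
pattern i6 = there i5
pattern i7 = there i6
pattern i8 = there i7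
pattern i9 = there i8
pattern i10 = there i9
pattern i11 = there i10
pattern i12 = there i11
pattern i13 = there i12
pattern i14 = there i13

pattern h0 = hyp i0
pattern h1 = hyp i1
pattern h2 = hyp i2
pattern h3 = hyp i3
pattern h4 = hyp i4
pattern h5 = hyp i5
pattern h6 = hyp i6
pattern h7 = hyp i7
pattern h8 = hyp i8
pattern h9 = hyp i9
pattern h10 = hyp i10
pattern h11 = hyp i11
pattern h12 = hyp i12
pattern h13 = hyp i13
pattern h14 = hyp i14

wk : T ⨾ Γ ⊢ φ → T ⨾ ψ ∷ Γ ⊢ φ
wk = monotone (xs⊆x∷xs _ _)

⊥E : T ⨾ Γ ⊢ ⊥ → T ⨾ Γ ⊢ φ
⊥E p = raa (wk p)

∧I : T ⨾ Γ ⊢ φ → T ⨾ Γ ⊢ ψ → T ⨾ Γ ⊢ φ ∧ ψ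
∧I p q = ⇒I (h0 ∙ wk p ∙ wk q)

∧E₁ : T ⨾ Γ ⊢ φ ∧ ψ → T ⨾ Γ ⊢ φ
∧E₁ p = raa (wk p ∙ ⇒I (⇒I (h2 ∙ h1)))

∧E₂ : T ⨾ Γ ⊢ φ ∧ ψ → T ⨾ Γ ⊢ ψ
∧E₂ p = raa (wk p ∙ ⇒I (h1))

∨I₁ : T ⨾ Γ ⊢ φ → T ⨾ Γ ⊢ φ ∨ ψ
∨I₁ p = ⇒I (⊥E (h0 ∙ wk p))

∨I₂ : T ⨾ Γ ⊢ ψ → T ⨾ Γ ⊢ φ ∨ ψ
∨I₂ p = ⇒I (wk p)

by-cases : ∀ (φ : Formula ℓ n) → T ⨾ φ ∷ Γ ⊢ ψ → T ⨾ (¬ φ) ∷ Γ ⊢ ψ → T ⨾ Γ ⊢ ψ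
by-cases φ p q = raa (h0 ∙ (wk (⇒I q) ∙ ⇒I (h1 ∙ (wk (wk (⇒I p)) ∙ h0))))

∨E : T ⨾ Γ ⊢ φ ∨ ψ → T ⨾ φ ∷ Γ ⊢ χ → T ⨾ ψ ∷ Γ ⊢ χ → T ⨾ Γ ⊢ χ
∨E {φ = φ} p q r = by-cases φ q (wk (⇒I r) ∙ (wk p ∙ h0))

⇔₁ : T ⨾ Γ ⊢ (φ ⇔ ψ) → T ⨾ Γ ⊢ φ → T ⨾ Γ ⊢ ψ
⇔₁ p q = ∧E₁ p ∙ q

⇔₂ : T ⨾ Γ ⊢ (φ ⇔ ψ) → T ⨾ Γ ⊢ ψ → T ⨾ Γ ⊢ φ
⇔₂ p q = ∧E₂ p ∙ q

∃I : ∀ {φ : Formula ℓ (suc n)} t → T ⨾ Γ ⊢ φ [ t ] → T ⨾ Γ ⊢ ∃' φ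
∃I t p = ⇒I (∀E h0 t ∙ wk p)

∃E : ∀ {φ : Formula ℓ (suc n)} → T ⨾ Γ ⊢ ∃' φ → T ⨾ φ ∷ map weaken Γ ⊢ weaken ψ → T ⨾ Γ ⊢ ψ
∃E p q = raa (wk p ∙ ∀I (⇒I (h1 ∙ monotone (∷⁺ʳ _ there) q)))

cut : T ⨾ Γ ⊢ φ → T ⨾ φ ∷ Γ ⊢ ψ → T ⨾ Γ ⊢ ψ
cut p q = ⇒I q ∙ p

≐-sym : T ⨾ Γ ⊢ s ≐ t → T ⨾ Γ ⊢ t ≐ s
≐-sym {s = s} {t = t} p = subst (λ s′ → _ ⨾ _ ⊢ t ≐ s′) (subᵗ-inst-↑ t s)
  (≐E (x₀ ≐ s ↑ 1) p (subst (λ s′ → _ ⨾ _ ⊢ s ≐ s′) (sym (subᵗ-inst-↑ s s)) (≐I s)))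

≐-trans : T ⨾ Γ ⊢ s ≐ t → T ⨾ Γ ⊢ t ≐ u → T ⨾ Γ ⊢ s ≐ u
≐-trans {s = s} {t = t} {u = u} p q = subst (λ s′ → _ ⨾ _ ⊢ s′ ≐ u) (subᵗ-inst-↑ u s)
  (≐E (s ↑ 1 ≐ x₀) q (subst (λ s′ → _ ⨾ _ ⊢ s′ ≐ t) (sym (subᵗ-inst-↑ t s)) p))

congruence : ∀ (r : Term ℓ (suc n)) → T ⨾ Γ ⊢ s ≐ t → T ⨾ Γ ⊢ subᵗ (inst s) r ≐ subᵗ (inst t) r
congruence {s = s} {t = t} r p =
  subst (λ u → _ ⨾ _ ⊢ u ≐ subᵗ (inst t) r) (subᵗ-inst-↑ t (subᵗ (inst s) r))
    (≐E (subᵗ (inst s) r ↑ 1 ≐ r) p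
      (subst (λ u → _ ⨾ _ ⊢ u ≐ subᵗ (inst s) r) (sym (subᵗ-inst-↑ s (subᵗ (inst s) r)))
        (≐I (subᵗ (inst s) r))))

⊕-cong : T ⨾ Γ ⊢ s ≐ s′ → T ⨾ Γ ⊢ t ≐ t′ → T ⨾ Γ ⊢ s ⊕ t ≐ s′ ⊕ t′
⊕-cong {s = s} {s′ = s′} {t = t} {t′ = t′} p q = ≐-trans
  (subst (λ u → _ ⨾ _ ⊢ s ⊕ u ≐ s′ ⊕ t) (subᵗ-inst-↑ s t)
    (subst (λ u → _ ⨾ _ ⊢ _ ≐ s′ ⊕ u) (subᵗ-inst-↑ s′ t) (congruence (x₀ ⊕ t ↑ 1) p)))
  (subst (λ u → _ ⨾ _ ⊢ u ⊕ t ≐ s′ ⊕ t′) (subᵗ-inst-↑ t s′)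
    (subst (λ u → _ ⨾ _ ⊢ _ ≐ u ⊕ t′) (subᵗ-inst-↑ t′ s′) (congruence (s′ ↑ 1 ⊕ x₀) q)))

⊗-cong : T ⨾ Γ ⊢ s ≐ s′ → T ⨾ Γ ⊢ t ≐ t′ → T ⨾ Γ ⊢ s ⊗ t ≐ s′ ⊗ t′
⊗-cong {s = s} {s′ = s′} {t = t} {t′ = t′} p q = ≐-trans
  (subst (λ u → _ ⨾ _ ⊢ s ⊗ u ≐ s′ ⊗ t) (subᵗ-inst-↑ s t)
    (subst (λ u → _ ⨾ _ ⊢ _ ≐ s′ ⊗ u) (subᵗ-inst-↑ s′ t) (congruence (x₀ ⊗ t ↑ 1) p)))
  (subst (λ u → _ ⨾ _ ⊢ u ⊗ t ≐ s′ ⊗ t′) (subᵗ-inst-↑ t s′)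
    (subst (λ u → _ ⨾ _ ⊢ _ ≐ u ⊗ t′) (subᵗ-inst-↑ t′ s′) (congruence (s′ ↑ 1 ⊗ x₀) q)))

infix 0 ⊢⟨_⟩_

⊢⟨_⟩_ : ∀ n → Formula L n → Set
⊢⟨ n ⟩ φ = IΣ₁ ⨾ [] ⊢ φ

-- The i-th entry of ts replaces xᵢ, so parameters are listed innermost first.
use : ∀ {m n} {φ : Formula L m} {Γ : List (Formula L n)} →
      ⊢⟨ m ⟩ φ → (ts : Vec (Term L n) m) → IΣ₁ ⨾ Γ ⊢ sub (lookup ts) φ
use p ts = instantiate (lookup ts) p

-- The hypotheses in `Γ` are available in both premises without entering the induction formula, so
-- they may be of any complexity; primality and `PrimesDivide`, for example, are not syntactically
-- Σ₁.
induct : ∀ (φ : Formula L (suc n)) → Σ₁ φ →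
         IΣ₁ ⨾ Γ ⊢ φ [ 𝟎 ] → IΣ₁ ⨾ φ ∷ map weaken Γ ⊢ φ [x₀+1] → IΣ₁ ⨾ Γ ⊢ ∀' φ
induct {n = n} {Γ = Γ} φ Σφ base step =
  subst (IΣ₁ ⨾ Γ ⊢_) (sub-var (λ _ → refl) _) (∀*E n (ax (induction Σφ)) var)
    ∙ ∧I base (∀I (⇒I step))

open∀ : {φ : Formula ℓ (suc n)} → T ⨾ [] ⊢ ∀' φ → T ⨾ [] ⊢ φ
open∀ {φ = φ} p = subst (_ ⨾ [] ⊢_)
  (trans (sub-∘ (inst x₀) (under (var ∘ suc)) φ)
         (sub-var (λ { zero → refl ; (suc i) → refl }) φ))
  (∀E (instantiate (var ∘ suc) p) x₀)

induct₀ : ∀ (φ : Formula L (suc n)) → Σ₁ φ →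
          ⊢⟨ n ⟩ φ [ 𝟎 ] → IΣ₁ ⨾ φ ∷ [] ⊢ φ [x₀+1] → ⊢⟨ suc n ⟩ φ
induct₀ φ Σφ base step = open∀ (induct φ Σφ base step)

-- Semiring laws

⊕-identityʳ : ∀ s → IΣ₁ ⨾ Γ ⊢ s ⊕ 𝟎 ≐ s
⊕-identityʳ s = axiom 1 +-zero (s ∷ [])

⊕-sucʳ : ∀ s t → IΣ₁ ⨾ Γ ⊢ s ⊕ (t ⊕ 𝟏) ≐ (s ⊕ t) ⊕ 𝟏
⊕-sucʳ s t = axiom 2 +-suc (t ∷ s ∷ [])

⊗-zeroʳ : ∀ s → IΣ₁ ⨾ Γ ⊢ s ⊗ 𝟎 ≐ 𝟎
⊗-zeroʳ s = axiom 1 *-zero (s ∷ [])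

⊗-sucʳ : ∀ s t → IΣ₁ ⨾ Γ ⊢ s ⊗ (t ⊕ 𝟏) ≐ s ⊗ t ⊕ s
⊗-sucʳ s t = axiom 2 *-suc (t ∷ s ∷ [])

⊕-identityˡ : ∀ s → IΣ₁ ⨾ Γ ⊢ 𝟎 ⊕ s ≐ s
⊕-identityˡ s = use law (s ∷ [])
  where
  law : ⊢⟨ 1 ⟩ 𝟎 ⊕ x₀ ≐ x₀
  law = induct₀ _ (Δ₀⇒Σ₁ (eq _ _)) (⊕-identityʳ 𝟎) (≐-trans (⊕-sucʳ 𝟎 x₀) (⊕-cong h0 (≐I 𝟏)))

⊕-sucˡ : ∀ s t → IΣ₁ ⨾ Γ ⊢ (s ⊕ 𝟏) ⊕ t ≐ (s ⊕ t) ⊕ 𝟏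
⊕-sucˡ s t = use law (t ∷ s ∷ [])
  where
  law : ⊢⟨ 2 ⟩ (x₁ ⊕ 𝟏) ⊕ x₀ ≐ (x₁ ⊕ x₀) ⊕ 𝟏
  law = induct₀ _ (Δ₀⇒Σ₁ (eq _ _))
    (≐-trans (⊕-identityʳ _) (⊕-cong (≐-sym (⊕-identityʳ _)) (≐I 𝟏)))
    (≐-trans (⊕-sucʳ _ _) (⊕-cong (≐-trans h0 (≐-sym (⊕-sucʳ _ _))) (≐I 𝟏)))

⊕-comm : ∀ s t → IΣ₁ ⨾ Γ ⊢ s ⊕ t ≐ t ⊕ s
⊕-comm s t = use law (t ∷ s ∷ [])
  where
  law : ⊢⟨ 2 ⟩ x₁ ⊕ x₀ ≐ x₀ ⊕ x₁
  law = induct₀ _ (Δ₀⇒Σ₁ (eq _ _))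
    (≐-trans (⊕-identityʳ _) (≐-sym (⊕-identityˡ _)))
    (≐-trans (⊕-sucʳ _ _) (≐-trans (⊕-cong h0 (≐I 𝟏)) (≐-sym (⊕-sucˡ _ _))))

⊕-assoc : ∀ s t u → IΣ₁ ⨾ Γ ⊢ (s ⊕ t) ⊕ u ≐ s ⊕ (t ⊕ u)
⊕-assoc s t u = use law (u ∷ t ∷ s ∷ [])
  where
  law : ⊢⟨ 3 ⟩ (x₂ ⊕ x₁) ⊕ x₀ ≐ x₂ ⊕ (x₁ ⊕ x₀)
  law = induct₀ _ (Δ₀⇒Σ₁ (eq _ _))
    (≐-trans (⊕-identityʳ _) (⊕-cong (≐I _) (≐-sym (⊕-identityʳ _))))
    (≐-trans (⊕-sucʳ _ _) (≐-trans (⊕-cong h0 (≐I 𝟏))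
      (≐-trans (≐-sym (⊕-sucʳ _ _)) (⊕-cong (≐I _) (≐-sym (⊕-sucʳ _ _))))))

⊕-left-comm : ∀ s t u → IΣ₁ ⨾ Γ ⊢ s ⊕ (t ⊕ u) ≐ t ⊕ (s ⊕ u)
⊕-left-comm s t u = ≐-trans (≐-sym (⊕-assoc s t u))
  (≐-trans (⊕-cong (⊕-comm s t) (≐I u)) (⊕-assoc t s u))

⊗-zeroˡ : ∀ s → IΣ₁ ⨾ Γ ⊢ 𝟎 ⊗ s ≐ 𝟎
⊗-zeroˡ s = use law (s ∷ [])
  where
  law : ⊢⟨ 1 ⟩ 𝟎 ⊗ x₀ ≐ 𝟎
  law = induct₀ _ (Δ₀⇒Σ₁ (eq _ _)) (⊗-zeroʳ 𝟎)
    (≐-trans (⊗-sucʳ 𝟎 x₀) (≐-trans (⊕-identityʳ _) h0))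

⊗-sucˡ : ∀ s t → IΣ₁ ⨾ Γ ⊢ (s ⊕ 𝟏) ⊗ t ≐ s ⊗ t ⊕ t
⊗-sucˡ s t = use law (t ∷ s ∷ [])
  where
  law : ⊢⟨ 2 ⟩ (x₁ ⊕ 𝟏) ⊗ x₀ ≐ x₁ ⊗ x₀ ⊕ x₀
  law = induct₀ _ (Δ₀⇒Σ₁ (eq _ _))
    (≐-trans (⊗-zeroʳ _) (≐-trans (≐-sym (⊗-zeroʳ _)) (≐-sym (⊕-identityʳ _))))
    (≐-trans (⊗-sucʳ _ _) (≐-trans (⊕-sucʳ _ _) (≐-trans
      (⊕-cong (≐-trans (⊕-cong h0 (≐I _)) (≐-trans (⊕-assoc _ _ _)
        (≐-trans (⊕-cong (≐I _) (⊕-comm _ _)) (≐-sym (⊕-assoc _ _ _))))) (≐I 𝟏))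
      (≐-trans (≐-sym (⊕-sucʳ _ _)) (⊕-cong (≐-sym (⊗-sucʳ _ _)) (≐I _))))))

⊗-comm : ∀ s t → IΣ₁ ⨾ Γ ⊢ s ⊗ t ≐ t ⊗ s
⊗-comm s t = use law (t ∷ s ∷ [])
  where
  law : ⊢⟨ 2 ⟩ x₁ ⊗ x₀ ≐ x₀ ⊗ x₁
  law = induct₀ _ (Δ₀⇒Σ₁ (eq _ _))
    (≐-trans (⊗-zeroʳ _) (≐-sym (⊗-zeroˡ _)))
    (≐-trans (⊗-sucʳ _ _) (≐-trans (⊕-cong h0 (≐I _)) (≐-sym (⊗-sucˡ _ _))))

distribˡ : ∀ s t u → IΣ₁ ⨾ Γ ⊢ s ⊗ (t ⊕ u) ≐ s ⊗ t ⊕ s ⊗ u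
distribˡ s t u = use law (u ∷ t ∷ s ∷ [])
  where
  law : ⊢⟨ 3 ⟩ x₂ ⊗ (x₁ ⊕ x₀) ≐ x₂ ⊗ x₁ ⊕ x₂ ⊗ x₀
  law = induct₀ _ (Δ₀⇒Σ₁ (eq _ _))
    (≐-trans (⊗-cong (≐I _) (⊕-identityʳ _)) (≐-trans (≐-sym (⊕-identityʳ _)) (⊕-cong (≐I _) (≐-sym (⊗-zeroʳ _)))))
    (≐-trans (⊗-cong (≐I _) (⊕-sucʳ _ _)) (≐-trans (⊗-sucʳ _ _) (≐-trans (⊕-cong h0 (≐I _))
      (≐-trans (⊕-assoc _ _ _) (⊕-cong (≐I _) (≐-sym (⊗-sucʳ _ _)))))))

distribʳ : ∀ s t u → IΣ₁ ⨾ Γ ⊢ (s ⊕ t) ⊗ u ≐ s ⊗ u ⊕ t ⊗ u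
distribʳ s t u = ≐-trans (⊗-comm _ u) (≐-trans (distribˡ u s t) (⊕-cong (⊗-comm u s) (⊗-comm u t)))

⊗-assoc : ∀ s t u → IΣ₁ ⨾ Γ ⊢ (s ⊗ t) ⊗ u ≐ s ⊗ (t ⊗ u)
⊗-assoc s t u = use law (u ∷ t ∷ s ∷ [])
  where
  law : ⊢⟨ 3 ⟩ (x₂ ⊗ x₁) ⊗ x₀ ≐ x₂ ⊗ (x₁ ⊗ x₀)
  law = induct₀ _ (Δ₀⇒Σ₁ (eq _ _))
    (≐-trans (⊗-zeroʳ _) (≐-trans (≐-sym (⊗-zeroʳ _)) (⊗-cong (≐I _) (≐-sym (⊗-zeroʳ _)))))
    (≐-trans (⊗-sucʳ _ _) (≐-trans (⊕-cong h0 (≐I _))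
      (≐-trans (≐-sym (distribˡ _ _ _)) (⊗-cong (≐I _) (≐-sym (⊗-sucʳ _ _))))))

⊗-left-comm : ∀ s t u → IΣ₁ ⨾ Γ ⊢ s ⊗ (t ⊗ u) ≐ t ⊗ (s ⊗ u)
⊗-left-comm s t u = ≐-trans (≐-sym (⊗-assoc s t u))
  (≐-trans (⊗-cong (⊗-comm s t) (≐I u)) (⊗-assoc t s u))

⊗-identityʳ : ∀ s → IΣ₁ ⨾ Γ ⊢ s ⊗ 𝟏 ≐ s
⊗-identityʳ s = ≐-trans (⊗-cong (≐I s) (≐-sym (⊕-identityˡ 𝟏)))
  (≐-trans (⊗-sucʳ s 𝟎) (≐-trans (⊕-cong (⊗-zeroʳ s) (≐I s)) (⊕-identityˡ s)))

⊗-identityˡ : ∀ s → IΣ₁ ⨾ Γ ⊢ 𝟏 ⊗ s ≐ s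
⊗-identityˡ s = ≐-trans (⊗-comm 𝟏 s) (⊗-identityʳ s)

-- A reflective solver for semiring identities between L-terms.  Normal forms are sorted
-- lists of monomials, which are sorted lists of variables; coefficients are unary.

Monomial Polynomial : ℕ → Set
Monomial n   = List (Fin n)
Polynomial n = List (Monomial n)

precedes : Monomial n → Monomial n → Bool
precedes []      _        = true
precedes (_ ∷ _) []       = false
precedes (i ∷ p) (j ∷ q)  =
  if toℕ i <ᵇ toℕ j then true else if toℕ j <ᵇ toℕ i then false else precedes p q

insertᵛ : Fin n → Monomial n → Monomial n
insertᵛ i []      = i ∷ []
insertᵛ i (j ∷ p) = if toℕ i <ᵇ toℕ j then i ∷ j ∷ p else j ∷ insertᵛ i p

insertᵐ : Monomial n → Polynomial n → Polynomial n
insertᵐ p []      = p ∷ []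
insertᵐ p (q ∷ r) = if precedes p q then p ∷ q ∷ r else q ∷ insertᵐ p r

_⊗ᵐ_ : Monomial n → Monomial n → Monomial n
p ⊗ᵐ q = foldr insertᵛ q p

_⊕ᵖ_ _⊗ᵖ_ : Polynomial n → Polynomial n → Polynomial n
p ⊕ᵖ q = foldr insertᵐ q p
p ⊗ᵖ q = foldr (λ a r → foldr (λ b → insertᵐ (a ⊗ᵐ b)) r q) [] p

normalize : Term L n → Polynomial n
normalize (var i) = (i ∷ []) ∷ []
normalize 𝟎       = []
normalize 𝟏       = [] ∷ []
normalize (s ⊕ t) = normalize s ⊕ᵖ normalize t
normalize (s ⊗ t) = normalize s ⊗ᵖ normalize t

⟦_⟧ᵐ : Monomial n → Term L n
⟦_⟧ᵐ = foldr (λ i t → var i ⊗ t) 𝟏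

⟦_⟧ : Polynomial n → Term L n
⟦_⟧ = foldr (λ p t → ⟦ p ⟧ᵐ ⊕ t) 𝟎

insertᵛ-sound : ∀ (i : Fin n) p → IΣ₁ ⨾ Γ ⊢ var i ⊗ ⟦ p ⟧ᵐ ≐ ⟦ insertᵛ i p ⟧ᵐ
insertᵛ-sound i []      = ≐I _
insertᵛ-sound i (j ∷ p) with toℕ i <ᵇ toℕ j
... | true  = ≐I _
... | false = ≐-trans (⊗-left-comm _ _ _) (⊗-cong (≐I _) (insertᵛ-sound i p))

insertᵐ-sound : ∀ (p : Monomial n) q → IΣ₁ ⨾ Γ ⊢ ⟦ p ⟧ᵐ ⊕ ⟦ q ⟧ ≐ ⟦ insertᵐ p q ⟧
insertᵐ-sound p []      = ≐I _
insertᵐ-sound p (q ∷ r) with precedes p q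
... | true  = ≐I _
... | false = ≐-trans (⊕-left-comm _ _ _) (⊕-cong (≐I _) (insertᵐ-sound p r))

⊗ᵐ-sound : ∀ (p q : Monomial n) → IΣ₁ ⨾ Γ ⊢ ⟦ p ⟧ᵐ ⊗ ⟦ q ⟧ᵐ ≐ ⟦ p ⊗ᵐ q ⟧ᵐ
⊗ᵐ-sound []      q = ⊗-identityˡ _
⊗ᵐ-sound (i ∷ p) q = ≐-trans (⊗-assoc _ _ _)
  (≐-trans (⊗-cong (≐I _) (⊗ᵐ-sound p q)) (insertᵛ-sound i (p ⊗ᵐ q)))

⊕ᵖ-sound : ∀ (p q : Polynomial n) → IΣ₁ ⨾ Γ ⊢ ⟦ p ⟧ ⊕ ⟦ q ⟧ ≐ ⟦ p ⊕ᵖ q ⟧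
⊕ᵖ-sound []      q = ⊕-identityˡ _
⊕ᵖ-sound (a ∷ p) q = ≐-trans (⊕-assoc _ _ _)
  (≐-trans (⊕-cong (≐I _) (⊕ᵖ-sound p q)) (insertᵐ-sound a (p ⊕ᵖ q)))

⊗ᵖ-sound : ∀ (p q : Polynomial n) → IΣ₁ ⨾ Γ ⊢ ⟦ p ⟧ ⊗ ⟦ q ⟧ ≐ ⟦ p ⊗ᵖ q ⟧
⊗ᵖ-sound []      q = ⊗-zeroˡ _
⊗ᵖ-sound (a ∷ p) q = ≐-trans (distribʳ _ _ _)
  (≐-trans (⊕-cong (≐I _) (⊗ᵖ-sound p q)) (scale q {p ⊗ᵖ q}))
  where
  scale : ∀ q {r} → IΣ₁ ⨾ Γ ⊢ ⟦ a ⟧ᵐ ⊗ ⟦ q ⟧ ⊕ ⟦ r ⟧ ≐ ⟦ foldr (λ b → insertᵐ (a ⊗ᵐ b)) r q ⟧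
  scale [] {r}      = ≐-trans (⊕-cong (⊗-zeroʳ _) (≐I _)) (⊕-identityˡ _)
  scale (b ∷ q) {r} = ≐-trans (⊕-cong (distribˡ _ _ _) (≐I _)) (≐-trans (⊕-assoc _ _ _)
    (≐-trans (⊕-cong (⊗ᵐ-sound a b) (scale q {r}))
      (insertᵐ-sound (a ⊗ᵐ b) (foldr (λ b′ → insertᵐ (a ⊗ᵐ b′)) r q))))

normalize-sound : ∀ (t : Term L n) → IΣ₁ ⨾ Γ ⊢ t ≐ ⟦ normalize t ⟧
normalize-sound (var i) = ≐-sym (≐-trans (⊕-identityʳ _) (⊗-identityʳ _))
normalize-sound 𝟎       = ≐I 𝟎
normalize-sound 𝟏       = ≐-sym (⊕-identityʳ _)
normalize-sound (s ⊕ t) = ≐-trans (⊕-cong (normalize-sound s) (normalize-sound t))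
  (⊕ᵖ-sound (normalize s) (normalize t))
normalize-sound (s ⊗ t) = ≐-trans (⊗-cong (normalize-sound s) (normalize-sound t))
  (⊗ᵖ-sound (normalize s) (normalize t))

ring : normalize s ≡ normalize t → IΣ₁ ⨾ Γ ⊢ s ≐ t
ring {s = s} {t = t} p = ≐-trans (normalize-sound s)
  (subst (λ q → IΣ₁ ⨾ _ ⊢ ⟦ q ⟧ ≐ t) (sym p) (≐-sym (normalize-sound t)))

x₅ : Term ℓ (6 + n)
x₅ = var (suc (suc (suc (suc (suc zero)))))

x₆ : Term ℓ (7 + n)
x₆ = var (suc (suc (suc (suc (suc (suc zero))))))

x₇ : Term ℓ (8 + n)
x₇ = var (suc (suc (suc (suc (suc (suc (suc zero)))))))

x₈ : Term ℓ (9 + n)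
x₈ = var (suc (suc (suc (suc (suc (suc (suc (suc zero))))))))

x₉ : Term ℓ (10 + n)
x₉ = var (suc (suc (suc (suc (suc (suc (suc (suc (suc zero)))))))))

-- Order

⊕-cancelʳ : IΣ₁ ⨾ Γ ⊢ s ⊕ u ≐ t ⊕ u → IΣ₁ ⨾ Γ ⊢ s ≐ t
⊕-cancelʳ {s = s} {u = u} {t = t} p = use law (u ∷ t ∷ s ∷ []) ∙ p
  where
  law : ⊢⟨ 3 ⟩ x₂ ⊕ x₀ ≐ x₁ ⊕ x₀ ⇒ x₂ ≐ x₁
  law = induct₀ _ (Δ₀⇒Σ₁ (imp (eq _ _) (eq _ _)))
    (⇒I (≐-trans (≐-sym (⊕-identityʳ _)) (≐-trans h0 (⊕-identityʳ _))))
    (⇒I (h1 ∙ (axiom 2 suc-injective (x₁ ⊕ x₀ ∷ x₂ ⊕ x₀ ∷ []) ∙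
      ≐-trans (≐-sym (⊕-sucʳ _ _)) (≐-trans h0 (⊕-sucʳ _ _)))))

-- The side condition says that u − v = s − t, with the differences moved across.
linear-≐ : IΣ₁ ⨾ Γ ⊢ u ≐ v → normalize (s ⊕ v) ≡ normalize (t ⊕ u) → IΣ₁ ⨾ Γ ⊢ s ≐ t
linear-≐ {t = t} p r = ⊕-cancelʳ (≐-trans (ring {t = t ⊕ _} r) (⊕-cong (≐I t) p))

≤I : ∀ w → IΣ₁ ⨾ Γ ⊢ w ⊕ s ≐ t → IΣ₁ ⨾ Γ ⊢ s ≤ t
≤I {s = s} {t = t} w p = use law (t ∷ s ∷ w ∷ []) ∙ p
  where
  law : ⊢⟨ 3 ⟩ x₂ ⊕ x₁ ≐ x₀ ⇒ x₁ ≤ x₀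
  law = ⇒I (⇔₂ (axiom 2 ≤-def (x₀ ∷ x₁ ∷ [])) (∃I x₂ h0))

≤E : ⊢⟨ 2 ⟩ x₁ ≤ x₀ ⇒ ∃' (x₀ ⊕ x₂ ≐ x₁)
≤E = ⇒I (⇔₁ (axiom 2 ≤-def (x₀ ∷ x₁ ∷ [])) h0)

-- The side condition reads t - s = (v - u) + w, so `w` is the surplus of the goal over the
-- hypothesis. Several hypotheses are first multiplied and added into one inequality, which turns
-- nonlinear arguments into certificates checked by `ring`.
linear-≤ : ∀ w → IΣ₁ ⨾ Γ ⊢ u ≤ v → normalize (t ⊕ u) ≡ normalize (s ⊕ v ⊕ w) → IΣ₁ ⨾ Γ ⊢ s ≤ t
linear-≤ {u = u} {v = v} {t = t} {s = s} w p r =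
  use law (w ∷ t ∷ s ∷ v ∷ u ∷ []) ∙ p ∙ ring r
  where
  law : ⊢⟨ 5 ⟩ x₄ ≤ x₃ ⇒ x₁ ⊕ x₄ ≐ x₂ ⊕ x₃ ⊕ x₀ ⇒ x₂ ≤ x₁
  law = ⇒I (⇒I (∃E (use ≤E (x₃ ∷ x₄ ∷ []) ∙ h1)
    (≤I (x₀ ⊕ x₁) (linear-≐ (⊕-cong h0 (≐-sym h1)) refl))))

≤-reflexive : IΣ₁ ⨾ Γ ⊢ s ≐ t → IΣ₁ ⨾ Γ ⊢ s ≤ t
≤-reflexive p = ≤I 𝟎 (≐-trans (⊕-identityˡ _) p)

≤-intro : ∀ w → normalize t ≡ normalize (w ⊕ s) → IΣ₁ ⨾ Γ ⊢ s ≤ t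
≤-intro w r = ≤I w (≐-sym (ring r))

⊕-mono : IΣ₁ ⨾ Γ ⊢ s ≤ t → IΣ₁ ⨾ Γ ⊢ u ≤ v → IΣ₁ ⨾ Γ ⊢ s ⊕ u ≤ t ⊕ v
⊕-mono {s = s} {t = t} {u = u} {v = v} p q = use law (v ∷ u ∷ t ∷ s ∷ []) ∙ p ∙ q
  where
  law : ⊢⟨ 4 ⟩ x₃ ≤ x₂ ⇒ x₁ ≤ x₀ ⇒ x₃ ⊕ x₁ ≤ x₂ ⊕ x₀
  law = ⇒I (⇒I (∃E (use ≤E (x₂ ∷ x₃ ∷ []) ∙ h1) (∃E (use ≤E (x₁ ∷ x₂ ∷ []) ∙ h1)
    (≤I (x₀ ⊕ x₁) (linear-≐ (⊕-cong h0 h1) refl)))))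

⊗-mono : IΣ₁ ⨾ Γ ⊢ s ≤ t → IΣ₁ ⨾ Γ ⊢ u ≤ v → IΣ₁ ⨾ Γ ⊢ s ⊗ u ≤ t ⊗ v
⊗-mono {s = s} {t = t} {u = u} {v = v} p q = use law (v ∷ u ∷ t ∷ s ∷ []) ∙ p ∙ q
  where
  law : ⊢⟨ 4 ⟩ x₃ ≤ x₂ ⇒ x₁ ≤ x₀ ⇒ x₃ ⊗ x₁ ≤ x₂ ⊗ x₀
  law = ⇒I (⇒I (∃E (use ≤E (x₂ ∷ x₃ ∷ []) ∙ h1) (∃E (use ≤E (x₁ ∷ x₂ ∷ []) ∙ h1)
    (≤I (x₁ ⊗ x₃ ⊕ x₀ ⊗ x₅ ⊕ x₀ ⊗ x₁) (≐-trans (ring refl) (⊗-cong h1 h0))))))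

-- The refutational counterpart of `linear-≤`: the combined hypotheses yield u ≤ v, while u exceeds
-- v by the explicit positive amount w + 1.
absurd-≤ : ∀ w → IΣ₁ ⨾ Γ ⊢ u ≤ v → normalize u ≡ normalize (v ⊕ w ⊕ 𝟏) → IΣ₁ ⨾ Γ ⊢ φ
absurd-≤ {u = u} {v = v} w p r = ⊥E (use law (w ∷ v ∷ u ∷ []) ∙ p ∙ ring r)
  where
  law : ⊢⟨ 3 ⟩ x₂ ≤ x₁ ⇒ x₂ ≐ x₁ ⊕ x₀ ⊕ 𝟏 ⇒ ⊥
  law = ⇒I (⇒I (∃E (use ≤E (x₁ ∷ x₂ ∷ []) ∙ h1)
    (axiom 1 suc≢0 (x₀ ⊕ x₁ ∷ []) ∙ linear-≐ (⊕-cong h0 (≐-sym h1)) refl)))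

zero-or-suc : ⊢⟨ 1 ⟩ x₀ ≐ 𝟎 ∨ ∃' (x₁ ≐ x₀ ⊕ 𝟏)
zero-or-suc = axiom 1 0-or-suc (x₀ ∷ [])

≤-or-> : ⊢⟨ 2 ⟩ x₁ ≤ x₀ ∨ x₀ ⊕ 𝟏 ≤ x₁
≤-or-> = induct₀ _ (Δ₀⇒Σ₁ (imp (imp (le _ _) bot) (le _ _)))
  (∨E (use zero-or-suc (x₀ ∷ [])) (∨I₁ (≤-reflexive h0))
    (∨I₂ (∃E h0 (≤I x₀ (linear-≐ (≐-sym h0) refl)))))
  (∨E h0 (∨I₁ (linear-≤ 𝟏 h0 refl))
    (∃E (use ≤E (x₁ ∷ x₀ ⊕ 𝟏 ∷ []) ∙ h0)
      (∨E (use zero-or-suc (x₀ ∷ []))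
        (∨I₁ (≤-reflexive (linear-≐ (⊕-cong (≐-sym h1) h0) refl)))
        (∃E h0 (∨I₂ (≤I x₀ (linear-≐ (⊕-cong h2 (≐-sym h0)) refl)))))))

compare : ∀ s t → IΣ₁ ⨾ (s ≤ t) ∷ Γ ⊢ φ → IΣ₁ ⨾ (t ⊕ 𝟏 ≤ s) ∷ Γ ⊢ φ → IΣ₁ ⨾ Γ ⊢ φ
compare s t p q = ∨E (use ≤-or-> (t ∷ s ∷ [])) p q

≤-antisym : IΣ₁ ⨾ Γ ⊢ s ≤ t → IΣ₁ ⨾ Γ ⊢ t ≤ s → IΣ₁ ⨾ Γ ⊢ s ≐ t
≤-antisym {s = s} {t = t} p q = use law (t ∷ s ∷ []) ∙ p ∙ q
  where
  law : ⊢⟨ 2 ⟩ x₁ ≤ x₀ ⇒ x₀ ≤ x₁ ⇒ x₁ ≐ x₀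
  law = ⇒I (⇒I (∃E (use ≤E (x₀ ∷ x₁ ∷ []) ∙ h1) (∨E (use zero-or-suc (x₀ ∷ []))
    (linear-≐ (⊕-cong h1 (≐-sym h0)) refl)
    (∃E h0 (absurd-≤ x₀ (⊕-mono h3 (≤-reflexive (⊕-cong h2 (≐-sym h0)))) refl)))))

⊕1≤⇒< : IΣ₁ ⨾ Γ ⊢ s ⊕ 𝟏 ≤ t → IΣ₁ ⨾ Γ ⊢ s < t
⊕1≤⇒< {s = s} {t = t} p = use law (t ∷ s ∷ []) ∙ p
  where
  law : ⊢⟨ 2 ⟩ x₁ ⊕ 𝟏 ≤ x₀ ⇒ x₁ < x₀
  law = ⇒I (∧I (linear-≤ 𝟏 h0 refl)
    (⇒I (absurd-≤ 𝟎 (⊕-mono h1 (≤-reflexive (≐-sym h0))) refl)))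

<⇒⊕1≤ : IΣ₁ ⨾ Γ ⊢ s < t → IΣ₁ ⨾ Γ ⊢ s ⊕ 𝟏 ≤ t
<⇒⊕1≤ {s = s} {t = t} p = use law (t ∷ s ∷ []) ∙ p
  where
  law : ⊢⟨ 2 ⟩ x₁ < x₀ ⇒ x₁ ⊕ 𝟏 ≤ x₀
  law = ⇒I (compare x₀ x₁ (⊥E (∧E₂ h1 ∙ ≤-antisym (∧E₁ h1) h0)) h0)

≢0⇒1≤ : IΣ₁ ⨾ Γ ⊢ ¬ (s ≐ 𝟎) → IΣ₁ ⨾ Γ ⊢ 𝟏 ≤ s
≢0⇒1≤ {s = s} p = use law (s ∷ []) ∙ p
  where
  law : ⊢⟨ 1 ⟩ ¬ (x₀ ≐ 𝟎) ⇒ 𝟏 ≤ x₀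
  law = ⇒I (∃E (use zero-or-suc (x₀ ∷ []) ∙ h0) (≤I x₀ (≐-sym h0)))

infixr 8 _·≐_ _·≤_

_·≐_ : ∀ s → IΣ₁ ⨾ Γ ⊢ t ≐ u → IΣ₁ ⨾ Γ ⊢ s ⊗ t ≐ s ⊗ u
s ·≐ p = ⊗-cong (≐I s) p

_·≤_ : ∀ s → IΣ₁ ⨾ Γ ⊢ t ≤ u → IΣ₁ ⨾ Γ ⊢ s ⊗ t ≤ s ⊗ u
s ·≤ p = ⊗-mono (≤-reflexive (≐I s)) p

Δ₀-∧ : {φ ψ : Formula L n} → Δ₀ φ → Δ₀ ψ → Δ₀ (φ ∧ ψ)
Δ₀-∧ a b = imp (imp a (imp b bot)) bot

-- Division and divisibility

euclidean-division : ⊢⟨ 2 ⟩ 𝟏 ≤ x₁ ⇒ ∃' ∃' ((x₂ ≐ x₃ ⊗ x₁ ⊕ x₀) ∧ (x₀ ⊕ 𝟏 ≤ x₃))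
euclidean-division = ⇒I (∀E (induct {n = 2} (∃' ∃' ((x₂ ≐ x₄ ⊗ x₁ ⊕ x₀) ∧ (x₀ ⊕ 𝟏 ≤ x₄)))
  (ex (ex (Δ₀⇒Σ₁ (Δ₀-∧ (eq _ _) (le _ _)))))
  (∃I 𝟎 (∃I 𝟎 (∧I (ring refl) (linear-≤ 𝟎 h0 refl))))
  (∃E h0 (∃E h0 (compare (x₀ ⊕ 𝟏 ⊕ 𝟏) x₄
    (∃I x₁ (∃I (x₀ ⊕ 𝟏) (∧I (linear-≐ (∧E₁ h1) refl) h0)))
    (∃I (x₁ ⊕ 𝟏) (∃I 𝟎 (∧I
      (linear-≐ (⊕-cong (∧E₁ h1) (≤-antisym (∧E₂ h1) (linear-≤ 𝟎 h0 refl))) refl)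
      (linear-≤ x₀ (∧E₂ h1) refl)))))))) x₀)

divides : ∀ w → IΣ₁ ⨾ Γ ⊢ s ⊗ w ≐ t → IΣ₁ ⨾ Γ ⊢ s ∣ t
divides {s = s} {t = t} w p = use law (w ∷ t ∷ s ∷ []) ∙ p
  where
  law : ⊢⟨ 3 ⟩ x₂ ⊗ x₀ ≐ x₁ ⇒ x₂ ∣ x₁
  law = ⇒I (∃I x₀ h0)

∣⇒≤ : ⊢⟨ 2 ⟩ x₁ ∣ x₀ ⇒ 𝟏 ≤ x₀ ⇒ x₁ ≤ x₀
∣⇒≤ = ⇒I (⇒I (∃E h1 (∨E (use zero-or-suc (x₀ ∷ []))
  (absurd-≤ 𝟎 (⊕-mono h2 (≤-reflexive (⊕-cong (≐-sym h1) (x₂ ·≐ h0)))) refl)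
  (∃E h0 (≤I (x₀ ⊗ x₃) (linear-≐ (⊕-cong h2 (x₃ ·≐ ≐-sym h0)) refl))))))

-- If p divides m b with 0 < m < p, then p also divides ρ b for the remainder ρ of p modulo m,
-- so descent on m shows that p divides b.
prime-descent : ⊢⟨ 2 ⟩ Prime x₁ ⇒ ¬ (x₁ ∣ x₀) ⇒
  ∀' (∀≤ x₀ (∀≤ (x₀ ⊗ x₂) (𝟏 ≤ x₁ ⇒ x₁ ⊕ 𝟏 ≤ x₄ ⇒ x₄ ⊗ x₀ ≐ x₁ ⊗ x₃ ⇒ ⊥)))
-- Bounding the multiplier m by the induction variable gives course-of-values induction, and
-- bounding the cofactor of p by m b keeps the formula Δ₀.
prime-descent = ⇒I (⇒I (induct {n = 2} _
  (Δ₀⇒Σ₁ (ball _ (ball _ (imp (le _ _) (imp (le _ _) (imp (eq _ _) bot))))))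
  (∀I (⇒I (∀I (⇒I (⇒I (⇒I (⇒I (absurd-≤ 𝟎 (⊕-mono h2 h4) refl))))))))
  (∀I (⇒I (∀I (⇒I (⇒I (⇒I (⇒I
    (compare x₁ x₂
      (∀E (∀E h6 x₁ ∙ h0) x₀ ∙ h4 ∙ h3 ∙ h2 ∙ h1)
      (compare x₁ 𝟏
        (h8 ∙ divides x₀ (linear-≐ (⊕-cong h2 (⊗-cong (≤-antisym h0 h4) (≐I x₃))) refl))
        (∃E (use euclidean-division (x₄ ∷ x₁ ∷ []) ∙ h4) (∃E h0 (compare x₀ 𝟎
          (∨E (∀E (∧E₂ h12) x₃ ∙ divides x₁
                (linear-≐ (⊕-cong (≐-sym (∧E₁ h1)) (≤-antisym (≤-intro x₀ refl) h0)) refl))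
            (absurd-≤ 𝟎 (⊕-mono h4 (≤-reflexive h0)) refl)
            (absurd-≤ 𝟎 (⊕-mono h7 (≤-reflexive (≐-sym h0))) refl))
          -- With p = q m + ρ and p k = m b, the product ρ b equals p (b - q k), so b - q k is the
          -- new cofactor; q k > b would contradict p q k = q m b ≤ p b.
          (compare (x₁ ⊗ x₂) x₅
            (∃E (use ≤E (x₅ ∷ x₁ ⊗ x₂ ∷ []) ∙ h0) (cut {φ = x₇ ⊗ x₀ ≐ x₁ ⊗ x₆}
              (linear-≐ (⊕-cong (x₇ ·≐ h0) (⊕-cong (⊗-cong (∧E₁ h3) (≐I x₆)) (x₂ ·≐ ≐-sym h7))) refl)
              (∀E (∀E h13 x₁ ∙ linear-≤ 𝟎 (⊕-mono (∧E₂ h4) h12) refl) x₀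
                ∙ linear-≤ (x₄ ⊗ x₀) (⊕-mono (⊗-mono h9 (≤-reflexive (≐I x₀))) (≤-reflexive h0)) refl
                ∙ linear-≤ 𝟎 h3 refl
                ∙ linear-≤ 𝟏 (⊕-mono h9 (∧E₂ h4)) refl
                ∙ h0)))
            (absurd-≤ (x₀ ⊗ x₅ ⊕ x₃)
              (⊕-mono (x₆ ·≤ h0) (⊕-mono (x₁ ·≤ ≤-reflexive h6)
                (⊕-mono (⊗-mono (≤-reflexive (≐-sym (∧E₁ h2))) (≤-reflexive (≐I x₅))) h7))) refl))))))))))))))))

2≤prime : ⊢⟨ 1 ⟩ Prime x₀ ⇒ 𝟏 ⊕ 𝟏 ≤ x₀
2≤prime = ⇒I (<⇒⊕1≤ (∧E₁ h0))

-- Reducing the first factor modulo the prime leaves either zero or a positive multiplier below the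
-- prime, and `prime-descent` excludes the latter.
euclid : ⊢⟨ 3 ⟩ Prime x₂ ⇒ x₂ ∣ x₁ ⊗ x₀ ⇒ x₂ ∣ x₁ ∨ x₂ ∣ x₀
euclid = ⇒I (⇒I (by-cases (x₂ ∣ x₀) (∨I₂ h0) (∃E h1
  (∃E (use euclidean-division (x₂ ∷ x₃ ∷ []) ∙ linear-≤ 𝟏 (use 2≤prime (x₃ ∷ []) ∙ h3) refl) (∃E h0
    (compare x₀ 𝟎
      (∨I₁ (divides x₁
        (linear-≐ (⊕-cong (≐-sym (∧E₁ h1)) (≤-antisym (≤-intro x₀ refl) h0)) refl)))
      (compare (x₁ ⊗ x₃) x₂
        (∃E (use ≤E (x₂ ∷ x₁ ⊗ x₃ ∷ []) ∙ h0) (cut {φ = x₆ ⊗ x₀ ≐ x₁ ⊗ x₄}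
          (linear-≐ (⊕-cong (x₆ ·≐ h0) (⊕-cong h5 (⊗-cong (∧E₁ h3) (≐I x₄)))) refl)
          (⊥E (∀E (∀E (∀E (use prime-descent (x₄ ∷ x₆ ∷ []) ∙ h9 ∙ h7) x₁) x₁
            ∙ ≤-intro 𝟎 refl) x₀
            ∙ linear-≤ x₀ (⊕-mono (⊗-mono (use 2≤prime (x₆ ∷ []) ∙ h9) (≤-reflexive (≐I x₀)))
                (≤-reflexive h0)) refl
            ∙ linear-≤ 𝟎 h3 refl ∙ ∧E₂ h4 ∙ h0))))
        (absurd-≤ (x₀ ⊗ x₃ ⊕ 𝟏) (⊕-mono (x₅ ·≤ h0) (⊕-mono
          (⊗-mono (≤-reflexive (≐-sym (∧E₁ h2))) (≤-reflexive (≐I x₃)))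
          (⊕-mono (≤-reflexive (≐-sym h4)) (use 2≤prime (x₅ ∷ []) ∙ h7)))) refl))))))))

-- Gödel's β-function and radicals

remainder-unique : ⊢⟨ 5 ⟩ x₄ ⊗ x₃ ⊕ x₂ ≐ x₄ ⊗ x₁ ⊕ x₀ ⇒ x₂ ⊕ 𝟏 ≤ x₄ ⇒ x₀ ⊕ 𝟏 ≤ x₄ ⇒ x₂ ≐ x₀
remainder-unique = ⇒I (⇒I (⇒I (compare x₃ x₁
  (compare x₁ x₃
    (linear-≐ (⊕-cong h4 (x₄ ·≐ ≤-antisym h0 h1)) refl)
    (absurd-≤ x₀ (⊕-mono (x₄ ·≤ h0) (⊕-mono (≤-reflexive (≐-sym h4)) h3)) refl))
  (absurd-≤ x₂ (⊕-mono (x₄ ·≤ h0) (⊕-mono (≤-reflexive h3) h1)) refl))))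

β-intro : ⊢⟨ 5 ⟩ x₁ ⊕ 𝟏 ≤ 𝟏 ⊕ (x₂ ⊕ 𝟏) ⊗ x₃ ⇒ x₄ ≐ x₀ ⊗ (𝟏 ⊕ (x₂ ⊕ 𝟏) ⊗ x₃) ⊕ x₁ ⇒ β x₄ x₃ x₂ x₁
β-intro = ⇒I (⇒I (∧I (⊕1≤⇒< h1) (∃I x₀ (∧I
  (linear-≤ (x₀ ⊗ ((x₂ ⊕ 𝟏) ⊗ x₃) ⊕ x₁) (≤-reflexive (≐-sym h0)) refl) h0))))

β-elim : ⊢⟨ 4 ⟩ β x₃ x₂ x₁ x₀ ⇒ ∃' (x₄ ≐ x₀ ⊗ (𝟏 ⊕ (x₂ ⊕ 𝟏) ⊗ x₃) ⊕ x₁)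
β-elim = ⇒I (∃E (∧E₂ h0) (∃I x₀ (∧E₂ h0)))

β-< : ⊢⟨ 4 ⟩ β x₃ x₂ x₁ x₀ ⇒ x₀ ⊕ 𝟏 ≤ 𝟏 ⊕ (x₁ ⊕ 𝟏) ⊗ x₂
β-< = ⇒I (<⇒⊕1≤ (∧E₁ h0))

β-bounded : ⊢⟨ 4 ⟩ β x₃ x₂ x₁ x₀ ⇒ x₀ ≤ x₃
β-bounded = ⇒I (∃E (use β-elim (x₀ ∷ x₁ ∷ x₂ ∷ x₃ ∷ []) ∙ h0)
  (linear-≤ (x₀ ⊗ (𝟏 ⊕ (x₂ ⊕ 𝟏) ⊗ x₃)) (≤-reflexive (≐-sym h0)) refl))

β-unique : ⊢⟨ 5 ⟩ β x₄ x₃ x₂ x₁ ⇒ β x₄ x₃ x₂ x₀ ⇒ x₁ ≐ x₀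
β-unique = ⇒I (⇒I (∃E (use β-elim (x₁ ∷ x₂ ∷ x₃ ∷ x₄ ∷ []) ∙ h1)
  (∃E (use β-elim (x₁ ∷ x₃ ∷ x₄ ∷ x₅ ∷ []) ∙ h1)
    (use remainder-unique (x₂ ∷ x₀ ∷ x₃ ∷ x₁ ∷ 𝟏 ⊕ (x₄ ⊕ 𝟏) ⊗ x₅ ∷ [])
      ∙ linear-≐ (⊕-cong (≐-sym h1) h0) refl
      ∙ (use β-< (x₃ ∷ x₄ ∷ x₅ ∷ x₆ ∷ []) ∙ h3)
      ∙ (use β-< (x₂ ∷ x₄ ∷ x₅ ∷ x₆ ∷ []) ∙ h2)))))

RadStep : (z i v w : Term L n) → Formula L n
RadStep z i v w =
  (Prime (i ⊕ 𝟏) ∧ (i ⊕ 𝟏 ∣ z)) ∧ (w ≐ v ⊗ (i ⊕ 𝟏)) ∨ ¬ (Prime (i ⊕ 𝟏) ∧ (i ⊕ 𝟏 ∣ z)) ∧ (w ≐ v)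

-- The middle conjunct of Rad, with each ↑ k written as iterated ↑ 1 so that it commutes
-- definitionally with substitution of arbitrary terms.
RadSteps : (c d z : Term L n) → Formula L n
RadSteps c d z = ∀< z (∃≤ (c ↑ 1) (∃≤ ((c ↑ 1) ↑ 1)
  (β (((c ↑ 1) ↑ 1) ↑ 1) (((d ↑ 1) ↑ 1) ↑ 1) x₂ x₁ ∧ β (((c ↑ 1) ↑ 1) ↑ 1) (((d ↑ 1) ↑ 1) ↑ 1) (x₂ ⊕ 𝟏) x₀
    ∧ RadStep (((z ↑ 1) ↑ 1) ↑ 1) x₂ x₁ x₀)))

rad-step : ⊢⟨ 4 ⟩ RadSteps x₃ x₂ x₁ ⇒ x₀ ⊕ 𝟏 ≤ x₁ ⇒
  ∃' ∃' (β x₅ x₄ x₂ x₁ ∧ β x₅ x₄ (x₂ ⊕ 𝟏) x₀ ∧ RadStep x₃ x₂ x₁ x₀)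
rad-step = ⇒I (⇒I (∃E (∀E h1 x₀ ∙ linear-≤ 𝟏 h0 refl
    ∙ ⇒I (absurd-≤ 𝟎 (⊕-mono h1 (≤-reflexive (≐-sym h0))) refl))
  (∃E (∧E₂ h0) (∃I x₁ (∃I x₀ (∧E₂ h0))))))

Δ₀-β : ∀ (c d i v : Term L n) → Δ₀ (β c d i v)
Δ₀-β c d i v = Δ₀-∧ (Δ₀-∧ (le _ _) (imp (eq _ _) bot)) (bex c (eq _ _))

-- The i-th partial product of the radical has only prime factors up to i: by `euclid`, a larger
-- prime would have to divide an earlier product or the factor i + 1 < p. The values and cofactors
-- are bounded to make the induction formula Δ₀.
primes-of-partial-product : ⊢⟨ 4 ⟩ Prime x₀ ⇒ RadSteps x₃ x₂ x₁ ⇒ β x₃ x₂ 𝟎 𝟏 ⇒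
  ∀' (x₀ ≤ x₂ ⇒ x₀ ⊕ 𝟏 ≤ x₁ ⇒ ∀≤ x₄ (β x₅ x₄ x₁ x₀ ⇒ ∀≤ x₀ (x₃ ⊗ x₀ ≐ x₁ ⇒ ⊥)))
primes-of-partial-product = ⇒I (⇒I (⇒I (induct {n = 4} _
  (Δ₀⇒Σ₁ (imp (le _ _) (imp (le _ _) (ball _ (imp (Δ₀-β _ _ _ _) (ball _ (imp (eq _ _) bot)))))))
  (⇒I (⇒I (∀I (⇒I (⇒I (∀I (⇒I (⇒I
    (cut (use β-unique (𝟏 ∷ x₁ ∷ 𝟎 ∷ x₄ ∷ x₅ ∷ []) ∙ h2 ∙ h6)
      (∨E (use zero-or-suc (x₀ ∷ []))
        (absurd-≤ 𝟎 (≤-reflexive (⊕-cong (≐-sym h1) (⊕-cong (≐-sym h2) (x₂ ·≐ h0)))) refl)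
        (∃E h0 (absurd-≤ (x₃ ⊗ x₀) (⊕-mono (x₃ ·≤ ≤-reflexive (≐-sym h0))
          (⊕-mono (≤-reflexive h3) (⊕-mono (≤-reflexive h2)
            (use 2≤prime (x₃ ∷ []) ∙ h11)))) refl))))))))))))
  (⇒I (⇒I (∀I (⇒I (⇒I (∀I (⇒I (⇒I
    (∃E (use rad-step (x₂ ∷ x₄ ∷ x₅ ∷ x₆ ∷ []) ∙ h8 ∙ h5) (∃E h0
      (cut (use β-unique (x₃ ∷ x₀ ∷ x₄ ⊕ 𝟏 ∷ x₇ ∷ x₈ ∷ []) ∙ ∧E₁ (∧E₂ h0) ∙ h4)
        (cut {φ = x₅ ∣ x₁ ⇒ ⊥}
          (⇒I (∃E h0 (∀E (∀E (h11 ∙ linear-≤ 𝟏 h10 refl ∙ linear-≤ 𝟏 h9 refl) x₂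
              ∙ (use β-bounded (x₂ ∷ x₅ ∷ x₈ ∷ x₉ ∷ []) ∙ ∧E₁ h3) ∙ ∧E₁ h3) x₀
            ∙ linear-≤ x₀ (⊕-mono (⊗-mono (use 2≤prime (x₆ ∷ []) ∙ h14) (≤-reflexive (≐I x₀)))
                (≤-reflexive h0)) refl
            ∙ h0)))
          (∨E (∧E₂ (∧E₂ h2))
            (∨E (use euclid (x₄ ⊕ 𝟏 ∷ x₁ ∷ x₅ ∷ []) ∙ h14
                ∙ divides x₂ (linear-≐ (⊕-cong h5 (⊕-cong (≐-sym h2) (∧E₂ h0))) refl))
              (h2 ∙ h0)
              (absurd-≤ 𝟎 (⊕-mono (use ∣⇒≤ (x₄ ⊕ 𝟏 ∷ x₅ ∷ []) ∙ h0 ∙ ≤-intro x₄ refl) h10) refl))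
            (h1 ∙ divides x₂ (linear-≐ (⊕-cong h5 (⊕-cong (≐-sym h2) (∧E₂ h0))) refl))))))))))))))))))

prime-∤-partial-product : ⊢⟨ 6 ⟩ Prime x₂ ⇒ RadSteps x₅ x₄ x₃ ⇒ β x₅ x₄ 𝟎 𝟏 ⇒
  x₁ ≤ x₃ ⇒ x₁ ⊕ 𝟏 ≤ x₂ ⇒ β x₅ x₄ x₁ x₀ ⇒ x₂ ∣ x₀ ⇒ ⊥
prime-∤-partial-product = ⇒I (⇒I (⇒I (⇒I (⇒I (⇒I (⇒I (∃E h0
  (∀E (∀E (∀E (use primes-of-partial-product (x₃ ∷ x₄ ∷ x₅ ∷ x₆ ∷ []) ∙ h7 ∙ h6 ∙ h5) x₂ ∙ h4 ∙ h3) x₁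
      ∙ (use β-bounded (x₁ ∷ x₂ ∷ x₅ ∷ x₆ ∷ []) ∙ h2) ∙ h2) x₀
    ∙ linear-≤ x₀ (⊕-mono (⊗-mono (use 2≤prime (x₃ ∷ []) ∙ h7) (≤-reflexive (≐I x₀)))
        (≤-reflexive h0)) refl
    ∙ h0))))))))

-- For positive z this amounts to rad(z) ∣ w, but without a code for the radical, so it can be
-- composed and multiplied freely.
PrimesDivide : (z w : Term ℓ n) → Formula ℓ n
PrimesDivide z w = ∀' (Prime x₀ ⇒ x₀ ∣ z ↑ 1 ⇒ x₀ ∣ w ↑ 1)

-- If w = v k for the current product v and the next factor p is a prime dividing z, then p divides
-- w but not v, hence it divides k, and v p still divides w. The existential quantifiers stand
-- outside the implication to make the formula Σ₁.
partial-product-divides : ⊢⟨ 4 ⟩ PrimesDivide x₁ x₀ ⇒ RadSteps x₃ x₂ x₁ ⇒ β x₃ x₂ 𝟎 𝟏 ⇒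
  ∀' (∃' ∃' (x₂ ≤ x₄ ⇒ β x₆ x₅ x₂ x₁ ∧ (x₁ ⊗ x₀ ≐ x₃)))
partial-product-divides = ⇒I (⇒I (⇒I (induct {n = 4} _
  (ex (ex (Δ₀⇒Σ₁ (imp (le _ _) (Δ₀-∧ (Δ₀-β _ _ _ _) (eq _ _))))))
  (∃I 𝟏 (∃I x₀ (⇒I (∧I h1 (ring refl)))))
  (compare (x₀ ⊕ 𝟏) x₂
    (∃E h1 (∃E h0 (cut (h0 ∙ linear-≤ 𝟏 h2 refl)
      (∃E (use rad-step (x₂ ∷ x₄ ∷ x₅ ∷ x₆ ∷ []) ∙ h6 ∙ h3) (∃E h0
        (cut (use β-unique (x₃ ∷ x₁ ∷ x₄ ∷ x₇ ∷ x₈ ∷ []) ∙ ∧E₁ h0 ∙ ∧E₁ h2)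
          (∨E (∧E₂ (∧E₂ h1))
            (cut {φ = x₄ ⊕ 𝟏 ∣ x₃ ⊗ x₂}
              (∃E (∀E h11 (x₄ ⊕ 𝟏) ∙ ∧E₁ (∧E₁ h0) ∙ ∧E₂ (∧E₁ h0))
                (divides x₀ (linear-≐ (⊕-cong h0 (≐-sym (∧E₂ h5))) refl)))
              (∨E (use euclid (x₂ ∷ x₃ ∷ x₄ ⊕ 𝟏 ∷ []) ∙ ∧E₁ (∧E₁ h1) ∙ h0)
                (⊥E (use prime-∤-partial-product (x₃ ∷ x₄ ∷ x₄ ⊕ 𝟏 ∷ x₆ ∷ x₇ ∷ x₈ ∷ [])
                  ∙ ∧E₁ (∧E₁ h2) ∙ h12 ∙ h11 ∙ linear-≤ 𝟏 h9 refl ∙ ≤-intro 𝟎 refl ∙ ∧E₁ h6 ∙ h0))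
                (∃E h0 (∃I x₁ (∃I x₀ (⇒I (∧I (∧E₁ (∧E₂ h6)) (linear-≐
                  (⊕-cong (x₀ ·≐ ∧E₂ h4) (⊕-cong (((x₅ ⊕ 𝟏) ⊗ x₀) ·≐ h5)
                    (⊕-cong (x₄ ·≐ h1) (∧E₂ h8)))) refl))))))))
            (∃I x₀ (∃I x₂ (⇒I (∧I (∧E₁ (∧E₂ h3)) (linear-≐
              (⊕-cong (x₂ ·≐ ∧E₂ h1) (⊕-cong (x₂ ·≐ h2) (∧E₂ h5))) refl))))))))))))
    (∃I 𝟎 (∃I 𝟎 (⇒I (absurd-≤ 𝟎 (⊕-mono h0 h1) refl))))))))

rad-≤ : ⊢⟨ 3 ⟩ Rad x₂ x₁ ⇒ PrimesDivide x₂ x₀ ⇒ 𝟏 ≤ x₀ ⇒ x₁ ≤ x₀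
rad-≤ = ⇒I (⇒I (⇒I (∃E h2 (∃E h0
  (∃E (∀E (use partial-product-divides (x₂ ∷ x₄ ∷ x₀ ∷ x₁ ∷ [])
      ∙ h3 ∙ ∧E₁ (∧E₂ h0) ∙ ∧E₁ h0) x₄) (∃E h0
    (cut (h0 ∙ ≤-intro 𝟎 refl)
      (use ∣⇒≤ (x₄ ∷ x₅ ∷ []) ∙ divides x₀ (linear-≐ (⊕-cong (∧E₂ h0)
          (x₀ ·≐ (use β-unique (x₁ ∷ x₅ ∷ x₆ ∷ x₂ ∷ x₃ ∷ []) ∙ ∧E₂ (∧E₂ h3) ∙ ∧E₁ h0))) refl)
        ∙ h5))))))))

the : ∀ (φ : Formula ℓ n) → T ⨾ Γ ⊢ φ → T ⨾ Γ ⊢ φ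
the φ p = p

-- Powers with standard exponents

modulus : (i d : Term ℓ n) → Term ℓ n
modulus i d = 𝟏 ⊕ (i ⊕ 𝟏) ⊗ d

InvertibleMod : (M q : Term ℓ n) → Formula ℓ n
InvertibleMod M q = ∃' ∃' ((M ↑ 1) ↑ 1 ⊗ x₁ ≐ 𝟏 ⊕ (q ↑ 1) ↑ 1 ⊗ x₀)

-- From M t ≡ -1 modulo q, squaring gives M (M t²) ≡ 1. The exact quotient is k (M t - 1), whence
-- the demand that M t be positive.
minus-one-invertible : ⊢⟨ 4 ⟩ x₃ ⊗ x₂ ⊕ 𝟏 ≐ x₁ ⊗ x₀ ⇒ 𝟏 ≤ x₃ ⊗ x₂ ⇒ InvertibleMod x₃ x₁
minus-one-invertible = ⇒I (⇒I (∃E (use ≤E (x₃ ⊗ x₂ ∷ 𝟏 ∷ []) ∙ h0)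
  (∃I (x₃ ⊗ (x₄ ⊗ x₃)) (∃I (x₁ ⊗ x₀)
    (linear-≐ (⊕-cong (x₀ ·≐ h2) ((x₄ ⊗ x₃ ⊕ 𝟏) ·≐ ≐-sym h0)) refl)))))

invertible-⊗ : ⊢⟨ 3 ⟩ InvertibleMod x₂ x₀ ⇒ InvertibleMod x₁ x₀ ⇒ InvertibleMod (x₂ ⊗ x₁) x₀
invertible-⊗ = ⇒I (⇒I (∃E h1 (∃E h0 (∃E h2 (∃E h0
  (∃I (x₃ ⊗ x₁) (∃I (x₂ ⊕ x₀ ⊕ x₄ ⊗ x₂ ⊗ x₀)
    (≐-trans (ring refl) (≐-trans (⊗-cong h2 h0) (ring refl))))))))))

-- d is a common multiple of 1, …, b, so that the moduli with indices at most b are coprime.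
Multiple : (b d : Term ℓ n) → Formula ℓ n
Multiple b d = (𝟏 ≤ d) ∧ (∀' (x₀ ⊕ 𝟏 ≤ b ↑ 1 ⇒ x₀ ⊕ 𝟏 ∣ d ↑ 1))

-- With d = (j − i) d′, the product of modulus i d and (j + 1)² d′ is −1 modulo modulus j d.
coprime-moduli : ⊢⟨ 4 ⟩ Multiple x₃ x₂ ⇒ x₁ ⊕ 𝟏 ≤ x₀ ⇒ x₀ ≤ x₃ ⇒
  InvertibleMod (modulus x₁ x₂) (modulus x₀ x₂)
coprime-moduli = ⇒I (⇒I (⇒I (∃E (use ≤E (x₀ ∷ x₁ ⊕ 𝟏 ∷ []) ∙ h1)
  (∃E (∀E (∧E₂ h3) x₀ ∙ linear-≤ x₂ (⊕-mono (≤-reflexive h0) h1) refl)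
    (use minus-one-invertible ((x₂ ⊕ 𝟏) ⊗ (x₃ ⊕ 𝟏) ⊗ x₀ ⊕ 𝟏 ∷ modulus x₂ x₄ ∷
        (x₂ ⊕ 𝟏) ⊗ (x₂ ⊕ 𝟏) ⊗ x₀ ∷ modulus x₃ x₄ ∷ [])
      ∙ linear-≐ ((x₂ ⊕ 𝟏) ·≐ ⊕-cong (x₀ ·≐ ≐-sym h1) h0) refl
      ∙ compare x₀ 𝟎
          (absurd-≤ 𝟎 (⊕-mono ((x₁ ⊕ 𝟏) ·≤ h0)
            (⊕-mono (≤-reflexive (≐-sym h1)) (∧E₁ h5))) refl)
          (linear-≤ 𝟎 (⊗-mono (the (𝟏 ≤ modulus x₃ x₄) (≤-intro ((x₃ ⊕ 𝟏) ⊗ x₄) refl))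
            (⊗-mono (the (𝟏 ≤ (x₂ ⊕ 𝟏) ⊗ (x₂ ⊕ 𝟏)) (≤-intro (x₂ ⊗ (x₂ ⊕ 𝟏 ⊕ 𝟏)) refl)) h0)) refl))))))

-- Adding a multiple of `M` to the code does not change its remainder modulo a divisor of `M`, so
-- the entries already coded survive.
β-extend : ⊢⟨ 6 ⟩ β x₅ x₄ x₁ x₀ ⇒ modulus x₁ x₄ ∣ x₃ ⇒ β (x₅ ⊕ x₃ ⊗ x₂) x₄ x₁ x₀
β-extend = ⇒I (⇒I (∃E (use β-elim (x₀ ∷ x₁ ∷ x₄ ∷ x₅ ∷ []) ∙ h1) (∃E h1
  (use β-intro (x₁ ⊕ x₀ ⊗ x₄ ∷ x₂ ∷ x₃ ∷ x₆ ∷ x₇ ⊕ x₅ ⊗ x₄ ∷ [])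
    ∙ (use β-< (x₂ ∷ x₃ ∷ x₆ ∷ x₇ ∷ []) ∙ h3)
    ∙ linear-≐ (⊕-cong h1 (x₄ ·≐ ≐-sym h0)) refl))))

β-solve : ⊢⟨ 5 ⟩ InvertibleMod x₂ (modulus x₁ x₃) ⇒ x₀ ⊕ 𝟏 ≤ modulus x₁ x₃ ⇒
  ∃' β (x₅ ⊕ x₃ ⊗ x₀) x₄ x₂ x₁
β-solve = ⇒I (⇒I (∃E h1 (∃E h0
  -- The solution is M⁻¹ (v - c). Since (i + 1) d ≡ -1 for this modulus, the difference v - c is
  -- represented without subtraction by v + (i + 1) d c.
  (∃I (x₁ ⊗ (x₂ ⊕ (x₃ ⊕ 𝟏) ⊗ x₅ ⊗ x₆))
    (use β-intro (x₆ ⊕ x₀ ⊗ (x₂ ⊕ (x₃ ⊕ 𝟏) ⊗ x₅ ⊗ x₆) ∷ x₂ ∷ x₃ ∷ x₅ ∷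
        x₆ ⊕ x₄ ⊗ (x₁ ⊗ (x₂ ⊕ (x₃ ⊕ 𝟏) ⊗ x₅ ⊗ x₆)) ∷ [])
      ∙ h2
      ∙ linear-≐ ((x₂ ⊕ (x₃ ⊕ 𝟏) ⊗ x₅ ⊗ x₆) ·≐ h0) refl)))))

β-cong : ⊢⟨ 5 ⟩ x₂ ≐ x₁ ⇒ β x₄ x₃ x₂ x₀ ⇒ β x₄ x₃ x₁ x₀
β-cong = ⇒I (⇒I (≐E (β x₅ x₄ x₀ x₁) h1 h0))

-- The middle conjunct of Exp, written like RadSteps.
ExpSteps : (c d x y : Term L n) → Formula L n
ExpSteps c d x y = ∀< y (∃≤ (c ↑ 1) (∃≤ ((c ↑ 1) ↑ 1)
  (β (((c ↑ 1) ↑ 1) ↑ 1) (((d ↑ 1) ↑ 1) ↑ 1) x₂ x₁ ∧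
   β (((c ↑ 1) ↑ 1) ↑ 1) (((d ↑ 1) ↑ 1) ↑ 1) (x₂ ⊕ 𝟏) x₀ ∧
   (x₀ ≐ x₁ ⊗ (((x ↑ 1) ↑ 1) ↑ 1)))))

exp-step : ⊢⟨ 6 ⟩ β x₅ x₄ x₂ x₁ ⇒ β x₅ x₄ (x₂ ⊕ 𝟏) x₀ ⇒ x₀ ≐ x₁ ⊗ x₃ ⇒
  ∃≤ x₅ (∃≤ x₆ (β x₇ x₆ x₄ x₁ ∧ β x₇ x₆ (x₄ ⊕ 𝟏) x₀ ∧ (x₀ ≐ x₁ ⊗ x₅)))
exp-step = ⇒I (⇒I (⇒I (∃I x₁ (∧I (use β-bounded (x₁ ∷ x₂ ∷ x₄ ∷ x₅ ∷ []) ∙ h2)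
  (∃I x₀ (∧I (use β-bounded (x₀ ∷ x₂ ⊕ 𝟏 ∷ x₄ ∷ x₅ ∷ []) ∙ h1) (∧I h2 (∧I h1 h0))))))))

ModuliDivide : (y d M : Term L n) → Formula L n
ModuliDivide y d M = ∀' (x₀ ≤ y ↑ 1 ⇒ modulus x₀ (d ↑ 1) ∣ M ↑ 1)

ModuliCoprime : (y b d M : Term L n) → Formula L n
ModuliCoprime y b d M =
  ∀' (y ↑ 1 ⊕ 𝟏 ≤ x₀ ⇒ x₀ ≤ b ↑ 1 ⇒ InvertibleMod (M ↑ 1) (modulus x₀ (d ↑ 1)))

exp-steps-extend : ⊢⟨ 7 ⟩ ModuliDivide x₄ x₅ x₁ ⇒ ExpSteps x₂ x₅ x₆ x₄ ⇒ β x₂ x₅ x₄ x₃ ⇒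
  β (x₂ ⊕ x₁ ⊗ x₀) x₅ (x₄ ⊕ 𝟏) (x₃ ⊗ x₆) ⇒ ExpSteps (x₂ ⊕ x₁ ⊗ x₀) x₅ x₆ (x₄ ⊕ 𝟏)
exp-steps-extend = ⇒I (⇒I (⇒I (⇒I (∀I (⇒I (⇒I
  (cut (compare x₀ x₅ h0 (⊥E (h1 ∙ ≤-antisym h2 h0)))
    (compare (x₀ ⊕ 𝟏) x₅
      (∃E (∀E h6 x₀ ∙ h1 ∙ ⇒I (absurd-≤ 𝟎 (⊕-mono h1 (≤-reflexive (≐-sym h0))) refl))
        (∃E (∧E₂ h0)
          (use exp-step (x₀ ∷ x₁ ∷ x₂ ∷ x₉ ∷ x₈ ∷ x₅ ⊕ x₄ ⊗ x₃ ∷ [])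
            ∙ (use β-extend (x₁ ∷ x₂ ∷ x₃ ∷ x₄ ∷ x₈ ∷ x₅ ∷ []) ∙ ∧E₁ (∧E₂ h0) ∙ (∀E h9 x₂ ∙ h3))
            ∙ (use β-extend (x₀ ∷ x₂ ⊕ 𝟏 ∷ x₃ ∷ x₄ ∷ x₈ ∷ x₅ ∷ []) ∙ ∧E₁ (∧E₂ (∧E₂ h0))
                ∙ (∀E h9 (x₂ ⊕ 𝟏) ∙ h2))
            ∙ ∧E₂ (∧E₂ (∧E₂ h0)))))
      -- Here i = y, the only step that involves the newly added entry.
      (cut (≤-antisym {s = x₅} {t = x₀} (linear-≤ 𝟎 h0 refl) h1)
        (use exp-step (x₄ ⊗ x₇ ∷ x₄ ∷ x₀ ∷ x₇ ∷ x₆ ∷ x₃ ⊕ x₂ ⊗ x₁ ∷ [])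
          ∙ (use β-cong (x₄ ∷ x₀ ∷ x₅ ∷ x₆ ∷ x₃ ⊕ x₂ ⊗ x₁ ∷ []) ∙ h0
              ∙ (use β-extend (x₄ ∷ x₅ ∷ x₁ ∷ x₂ ∷ x₆ ∷ x₃ ∷ []) ∙ h6
                  ∙ (∀E h8 x₅ ∙ ≤-intro 𝟎 refl)))
          ∙ (use β-cong (x₄ ⊗ x₇ ∷ x₀ ⊕ 𝟏 ∷ x₅ ⊕ 𝟏 ∷ x₆ ∷ x₃ ⊕ x₂ ⊗ x₁ ∷ [])
              ∙ ⊕-cong h0 (≐I 𝟏) ∙ h5)
          ∙ ≐I _))))))))))

moduli-divide-extend : ⊢⟨ 3 ⟩ ModuliDivide x₂ x₁ x₀ ⇒
  ModuliDivide (x₂ ⊕ 𝟏) x₁ (x₀ ⊗ modulus (x₂ ⊕ 𝟏) x₁)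
moduli-divide-extend = ⇒I (∀I (⇒I (compare x₀ x₃
  (∃E (∀E h2 x₀ ∙ h0) (divides (x₀ ⊗ modulus (x₄ ⊕ 𝟏) x₃)
    (linear-≐ (modulus (x₄ ⊕ 𝟏) x₃ ·≐ h0) refl)))
  (divides x₁ (linear-≐ ((x₁ ⊗ x₂) ·≐ ≤-antisym h1 h0) refl)))))

moduli-coprime-extend : ⊢⟨ 4 ⟩ Multiple x₂ x₁ ⇒ ModuliCoprime x₃ x₂ x₁ x₀ ⇒
  ModuliCoprime (x₃ ⊕ 𝟏) x₂ x₁ (x₀ ⊗ modulus (x₃ ⊕ 𝟏) x₁)
moduli-coprime-extend = ⇒I (⇒I (∀I (⇒I (⇒I
  (use invertible-⊗ (modulus x₀ x₂ ∷ modulus (x₄ ⊕ 𝟏) x₂ ∷ x₁ ∷ [])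
    ∙ (∀E h2 x₀ ∙ linear-≤ 𝟏 h1 refl ∙ h0)
    ∙ (use coprime-moduli (x₀ ∷ x₄ ⊕ 𝟏 ∷ x₂ ∷ x₃ ∷ []) ∙ h3 ∙ h1 ∙ h0))))))

-- c and d code the powers x⁰, …, x^y, and M is a common multiple of the moduli used so far
-- that is still coprime to the remaining ones, so that one more power can be coded.
Code : (x b d y z c M : Term L n) → Formula L n
Code x b d y z c M =
  β c d 𝟎 𝟏 ∧ ExpSteps c d x y ∧ β c d y z ∧ ModuliDivide y d M ∧ ModuliCoprime y b d M

code-start : ⊢⟨ 3 ⟩ Multiple x₁ x₀ ⇒ ∃' ∃' Code x₄ x₃ x₂ 𝟎 𝟏 x₁ x₀
code-start = ⇒I (∃I 𝟏 (∃I (modulus 𝟎 x₀)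
  (cut (use β-intro (𝟎 ∷ 𝟏 ∷ 𝟎 ∷ x₀ ∷ 𝟏 ∷ []) ∙ linear-≤ 𝟎 (∧E₁ h0) refl ∙ ring refl)
    (∧I h0 (∧I (∀I (⇒I (⇒I (⊥E (h0 ∙ ≤-antisym h1 (≤-intro x₀ refl))))))
      (∧I h0 (∧I
        (∀I (⇒I (divides 𝟏 (linear-≐ (x₁ ·≐ ≤-antisym h0 (≤-intro x₀ refl)) refl))))
        (∀I (⇒I (⇒I (use coprime-moduli (x₀ ∷ 𝟎 ∷ x₁ ∷ x₂ ∷ []) ∙ h3 ∙ h1 ∙ h0)))))))))))

code-step : ⊢⟨ 7 ⟩ Multiple x₅ x₄ ⇒ x₃ ⊕ 𝟏 ≤ x₅ ⇒ x₂ ⊗ x₆ ≤ x₄ ⇒ Code x₆ x₅ x₄ x₃ x₂ x₁ x₀ ⇒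
  ∃' ∃' Code x₈ x₇ x₆ (x₅ ⊕ 𝟏) (x₄ ⊗ x₈) x₁ x₀
code-step = ⇒I (⇒I (⇒I (⇒I
  (∃E (use β-solve (x₂ ⊗ x₆ ∷ x₃ ⊕ 𝟏 ∷ x₀ ∷ x₄ ∷ x₁ ∷ [])
      ∙ (∀E (∧E₂ (∧E₂ (∧E₂ (∧E₂ h0)))) (x₃ ⊕ 𝟏) ∙ ≤-intro 𝟎 refl ∙ h2)
      -- A value not exceeding d is smaller than every modulus, so it can occur as a remainder.
      ∙ linear-≤ ((x₃ ⊕ 𝟏) ⊗ x₄) h1 refl)
    (cut (∧E₁ (∧E₂ (∧E₂ (∧E₂ h1))))
      (∃I (x₂ ⊕ x₁ ⊗ x₀) (∃I (x₁ ⊗ modulus (x₄ ⊕ 𝟏) x₅)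
        (∧I (use β-extend (𝟏 ∷ 𝟎 ∷ x₀ ∷ x₁ ∷ x₅ ∷ x₂ ∷ []) ∙ ∧E₁ h2 ∙ (∀E h0 𝟎 ∙ ≤-intro x₄ refl))
        (∧I (use exp-steps-extend (x₀ ∷ x₁ ∷ x₂ ∷ x₃ ∷ x₄ ∷ x₅ ∷ x₇ ∷ []) ∙ h0
            ∙ ∧E₁ (∧E₂ h2) ∙ ∧E₁ (∧E₂ (∧E₂ h2)) ∙ h1)
        (∧I h1
        (∧I (use moduli-divide-extend (x₁ ∷ x₅ ∷ x₄ ∷ []) ∙ h0)
            (use moduli-coprime-extend (x₁ ∷ x₅ ∷ x₆ ∷ x₄ ∷ []) ∙ h5
              ∙ ∧E₂ (∧E₂ (∧E₂ (∧E₂ h2)))))))))))))))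

-- A formula implying z = x^y that passes from (y , z) to (y + 1 , z x); hence it is
-- provable for every standard y.
Power : (x y z : Term L n) → Formula L n
Power x y z = ∃' (Multiple (y ↑ 1) x₀ ∧ (z ↑ 1 ≤ x₀)) ∧
  (∀' ∀' (Multiple x₁ x₀ ⇒ (y ↑ 1) ↑ 1 ≤ x₁ ⇒ (z ↑ 1) ↑ 1 ≤ x₀ ⇒
    ∃' ∃' Code ((((x ↑ 1) ↑ 1) ↑ 1) ↑ 1) x₃ x₂
      ((((y ↑ 1) ↑ 1) ↑ 1) ↑ 1) ((((z ↑ 1) ↑ 1) ↑ 1) ↑ 1) x₁ x₀))

power-zero : ⊢⟨ 1 ⟩ Power x₀ 𝟎 𝟏
power-zero = ∧I
  (∃I 𝟏 (∧I (∧I (≤-intro 𝟎 refl) (∀I (⇒I (absurd-≤ x₀ h0 refl)))) (≤-intro 𝟎 refl)))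
  (∀I (∀I (⇒I (⇒I (⇒I (use code-start (x₀ ∷ x₁ ∷ x₂ ∷ []) ∙ h2))))))

-- Changing d would change all the moduli and spoil the code. As `Power` provides codes for every
-- suitable b and d, the code for y can be taken with the parameters meant for y + 1, and then only
-- one entry has to be added.
power-suc : ⊢⟨ 3 ⟩ 𝟏 ≤ x₂ ⇒ Power x₂ x₁ x₀ ⇒ Power x₂ (x₁ ⊕ 𝟏) (x₀ ⊗ x₂)
power-suc = ⇒I (⇒I (∧I
  -- From d for y, take d (y + 1) (1 + z x): the second factor adds the divisor y + 1, the third
  -- makes the result at least z x.
  (∃E (∧E₁ h0) (∃I (x₀ ⊗ (x₂ ⊕ 𝟏) ⊗ (𝟏 ⊕ x₁ ⊗ x₃)) (∧I
    (∧I (linear-≤ (x₀ ⊗ (x₂ ⊕ x₁ ⊗ x₃ ⊕ x₂ ⊗ (x₁ ⊗ x₃))) (∧E₁ (∧E₁ h0)) refl)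
      (∀I (⇒I (compare (x₀ ⊕ 𝟏) x₃
        (∃E (∀E (∧E₂ (∧E₁ h2)) x₀ ∙ h0)
          (divides (x₀ ⊗ (x₄ ⊕ 𝟏) ⊗ (𝟏 ⊕ x₃ ⊗ x₅))
            (linear-≐ (((x₄ ⊕ 𝟏) ⊗ (𝟏 ⊕ x₃ ⊗ x₅)) ·≐ h0) refl)))
        (divides (x₁ ⊗ (𝟏 ⊕ x₂ ⊗ x₄))
          (linear-≐ ((x₁ ⊗ (𝟏 ⊕ x₂ ⊗ x₄)) ·≐ ≤-antisym h1 h0) refl))))))
    (linear-≤ (x₀ ⊕ x₀ ⊗ x₂ ⊗ (𝟏 ⊕ x₁ ⊗ x₃))
      ((x₁ ⊗ x₃) ·≤ ∧E₁ (∧E₁ h0)) refl))))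
  (∀I (∀I (⇒I (⇒I (⇒I (∃E (∀E (∀E (∧E₂ h3) x₁) x₀ ∙ h2 ∙ linear-≤ 𝟏 h1 refl
      ∙ linear-≤ 𝟎 (⊕-mono (x₂ ·≤ h4) h0) refl)
    (∃E h0 (use code-step (x₀ ∷ x₁ ∷ x₄ ∷ x₅ ∷ x₂ ∷ x₃ ∷ x₆ ∷ [])
      ∙ h4 ∙ h3 ∙ h2 ∙ h0))))))))))

-- The first half of `Power` supplies one suitable d, and b = y is enough for a code that ends at y.
power-exp : ⊢⟨ 3 ⟩ Power x₂ x₁ x₀ ⇒ Exp x₂ x₁ x₀
power-exp = ⇒I (∃E (∧E₁ h0)
  (∃E (∀E (∀E (∧E₂ h1) x₂) x₀ ∙ ∧E₁ h0 ∙ ≤-intro 𝟎 refl ∙ ∧E₂ h0) (∃E h0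
    (∃I x₁ (∃I x₂ (∧I (∧E₁ h0) (∧I (∧E₁ (∧E₂ h0)) (∧E₁ (∧E₂ (∧E₂ h0))))))))))

power-cong : ⊢⟨ 5 ⟩ x₃ ≐ x₂ ⇒ x₁ ≐ x₀ ⇒ Power x₄ x₃ x₁ ⇒ Power x₄ x₂ x₀
power-cong = ⇒I (⇒I (⇒I (≐E (Power x₅ x₃ x₀) h1 (≐E (Power x₅ x₀ x₂) h2 h0))))

-- Consequences of the abc conjecture

primes-divide-trans : ⊢⟨ 3 ⟩ PrimesDivide x₂ x₁ ⇒ PrimesDivide x₁ x₀ ⇒ PrimesDivide x₂ x₀
primes-divide-trans = ⇒I (⇒I (∀I (⇒I (⇒I (∀E h2 x₀ ∙ h1 ∙ (∀E h3 x₀ ∙ h1 ∙ h0))))))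

∣-⊗ʳ : ⊢⟨ 3 ⟩ x₂ ∣ x₁ ⇒ x₂ ∣ x₁ ⊗ x₀
∣-⊗ʳ = ⇒I (∃E h0 (divides (x₀ ⊗ x₁) (linear-≐ (x₁ ·≐ h0) refl)))

∣-⊗ˡ : ⊢⟨ 3 ⟩ x₂ ∣ x₀ ⇒ x₂ ∣ x₁ ⊗ x₀
∣-⊗ˡ = ⇒I (∃E h0 (divides (x₀ ⊗ x₂) (linear-≐ (x₂ ·≐ h0) refl)))

primes-divide-⊗ : ⊢⟨ 4 ⟩ PrimesDivide x₃ x₁ ⇒ PrimesDivide x₂ x₀ ⇒ PrimesDivide (x₃ ⊗ x₂) (x₁ ⊗ x₀)
primes-divide-⊗ = ⇒I (⇒I (∀I (⇒I (⇒I (∨E (use euclid (x₃ ∷ x₄ ∷ x₀ ∷ []) ∙ h1 ∙ h0)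
  (use ∣-⊗ʳ (x₁ ∷ x₂ ∷ x₀ ∷ []) ∙ (∀E h4 x₀ ∙ h2 ∙ h0))
  (use ∣-⊗ˡ (x₁ ∷ x₂ ∷ x₀ ∷ []) ∙ (∀E h3 x₀ ∙ h2 ∙ h0)))))))

primes-divide-cube : ⊢⟨ 2 ⟩ x₁ ∣ x₀ ⊗ x₀ ⊗ x₀ ⇒ PrimesDivide x₁ x₀
primes-divide-cube = ⇒I (∀I (⇒I (⇒I (∃E h2 (∃E h1 (cut {φ = x₂ ∣ x₃ ⊗ x₃ ⊗ x₃}
  (divides (x₀ ⊗ x₁) (linear-≐ (⊕-cong (x₁ ·≐ h0) h1) refl))
  (∨E (use euclid (x₃ ∷ x₃ ⊗ x₃ ∷ x₂ ∷ []) ∙ h4 ∙ h0)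
    (∨E (use euclid (x₃ ∷ x₃ ∷ x₂ ∷ []) ∙ h5 ∙ h0) h0 h0)
    h0)))))))

-- `Root` relates a power of x to the one with half the exponent, rounded down. An odd exponent
-- leaves over a factor x, which w contains, so z divides w³ in either case. This is what lets the
-- primes of z pass to w through repeated halving.
Root SquareRoot EighthRoot : (z w : Term ℓ n) → Formula ℓ n
Root z w       = (𝟏 ≤ w) ∧ (w ⊗ w ≤ z) ∧ (z ∣ w ⊗ w ⊗ w)
SquareRoot z w = (𝟏 ≤ w) ∧ (w ⊗ w ≤ z) ∧ PrimesDivide z w
EighthRoot z w = (𝟏 ≤ w) ∧ (w ^ 8 ≤ z) ∧ PrimesDivide z w

root-even : ⊢⟨ 2 ⟩ 𝟏 ≤ x₀ ⇒ x₁ ≐ x₀ ⊗ x₀ ⇒ Root x₁ x₀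
root-even = ⇒I (⇒I (∧I h1 (∧I (≤-reflexive (≐-sym h0))
  (divides x₀ (linear-≐ (x₀ ·≐ h0) refl)))))

root-odd : ⊢⟨ 4 ⟩ 𝟏 ≤ x₂ ⇒ 𝟏 ≤ x₀ ⇒ x₂ ≐ x₁ ⊗ x₀ ⇒ x₃ ≐ x₂ ⊗ x₂ ⊗ x₀ ⇒ Root x₃ x₂
root-odd = ⇒I (⇒I (⇒I (⇒I (∧I h3 (∧I
  (linear-≤ 𝟎 (⊕-mono ((x₂ ⊗ x₂) ·≤ h2) (≤-reflexive (≐-sym h0))) refl)
  (divides x₁ (linear-≐ (⊕-cong (x₁ ·≐ h0) ((x₂ ⊗ x₂) ·≐ ≐-sym h1)) refl)))))))

root⇒square-root : ⊢⟨ 2 ⟩ Root x₁ x₀ ⇒ SquareRoot x₁ x₀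
root⇒square-root = ⇒I (∧I (∧E₁ h0) (∧I (∧E₁ (∧E₂ h0))
  (use primes-divide-cube (x₀ ∷ x₁ ∷ []) ∙ ∧E₂ (∧E₂ h0))))

eighth-root : ⊢⟨ 4 ⟩ Root x₃ x₂ ⇒ Root x₂ x₁ ⇒ Root x₁ x₀ ⇒ EighthRoot x₃ x₀
eighth-root = ⇒I (⇒I (⇒I (∧I (∧E₁ h0) (∧I
  (cut (⊗-mono (∧E₁ (∧E₂ h0)) (∧E₁ (∧E₂ h0)))
    (linear-≤ 𝟎 (⊕-mono (⊗-mono h0 h0) (⊕-mono
      (⊗-mono (∧E₁ (∧E₂ h2)) (∧E₁ (∧E₂ h2))) (∧E₁ (∧E₂ h3)))) refl))
  (use primes-divide-trans (x₀ ∷ x₂ ∷ x₃ ∷ []) ∙ (use primes-divide-cube (x₂ ∷ x₃ ∷ []) ∙ ∧E₂ (∧E₂ h2))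
    ∙ (use primes-divide-trans (x₀ ∷ x₁ ∷ x₂ ∷ [])
      ∙ (use primes-divide-cube (x₁ ∷ x₂ ∷ []) ∙ ∧E₂ (∧E₂ h1))
      ∙ (use primes-divide-cube (x₀ ∷ x₁ ∷ []) ∙ ∧E₂ (∧E₂ h0))))))))

-- z³ < k³ r⁴ ≤ k³ u⁴ v⁴ ≤ k³ z² v⁴ gives z < k³ v⁴, whose square contradicts k⁶ ≤ z and v⁸ ≤ z.
abc-bound : ⊢⟨ 5 ⟩ x₃ ⊗ x₃ ≤ x₄ ⇒ x₂ ^ 8 ≤ x₄ ⇒ x₁ ≤ x₃ ⊗ x₂ ⇒ x₀ ^ 3 ⊗ x₀ ^ 3 ≤ x₄ ⇒
  x₄ ^ 3 < x₀ ^ 3 ⊗ x₁ ^ 4 ⇒ ⊥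
abc-bound = ⇒I (⇒I (⇒I (⇒I (⇒I (cut (⊗-mono h2 h2) (compare (x₄ ⊕ 𝟏) (x₀ ^ 3 ⊗ x₂ ^ 4)
  (absurd-≤ (x₄ ⊕ x₄) (⊕-mono (⊗-mono h0 h0) (⊗-mono h3 h5)) refl)
  (absurd-≤ 𝟎 (⊕-mono ((x₄ ⊗ x₄) ·≤ h0) (⊕-mono (<⇒⊕1≤ h2)
    (⊕-mono ((x₀ ^ 3) ·≤ ⊗-mono h1 h1) ((x₀ ^ 3 ⊗ x₂ ^ 4) ·≤ ⊗-mono h6 h6)))) refl)))))))

one-coprime : ⊢⟨ 1 ⟩ Coprime 𝟏 x₀
one-coprime = ∀I (⇒I (≤-antisym (use ∣⇒≤ (𝟏 ∷ x₀ ∷ []) ∙ ∧E₁ h0 ∙ ≤-intro 𝟎 refl)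
  (∃E (∧E₁ h0) (compare x₁ 𝟎
    (absurd-≤ 𝟎 (⊕-mono (≤-reflexive (≐-sym h1)) (⊗-mono h0 (≤-reflexive (≐I x₀)))) refl)
    (linear-≤ 𝟎 h0 refl)))))

suc-coprime : ⊢⟨ 2 ⟩ x₁ ⊕ 𝟏 ≐ x₀ ⇒ Coprime x₁ x₀
suc-coprime = ⇒I (∀I (⇒I (cut {φ = x₀ ∣ 𝟏}
  (∃E (∧E₁ h0) (∃E (∧E₂ h1) (compare x₁ x₀
    (∃E (use ≤E (x₀ ∷ x₁ ∷ []) ∙ h0) (divides x₀
      (linear-≐ (⊕-cong (x₃ ·≐ h0) (⊕-cong h2 (⊕-cong (≐-sym h3) (≐-sym h5)))) refl)))
    (absurd-≤ x₂ (⊕-mono (x₂ ·≤ h0) (⊕-mono (≤-reflexive (≐-sym h1))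
      (⊕-mono (≤-reflexive h2) (≤-reflexive h4)))) refl))))
  (∀E (use one-coprime (𝟏 ∷ [])) x₀ ∙ ∧I h0 h0))))

-- The abc conjecture with the constant as a variable.
ABC : Formula L 1
ABC = ∀' ∀' ∀'
  ( Coprime x₂ x₁ ∧ Coprime x₂ x₀ ∧ Coprime x₁ x₀ ⇒ x₂ ⊕ x₁ ≐ x₀ ⇒
    ∃' (Rad (x₃ ⊗ x₂ ⊗ x₁) x₀ ∧ (x₁ ^ 3 < x₄ ^ 3 ⊗ x₀ ^ 4)))

-- This isolates what the equation needs from abc in a formula without `e`, which can be derived in
-- L and lifted. X and Y stand for the two powers; the disjunction records which of them has the
-- large exponent.
NoLargeSolution : Formula L 1
NoLargeSolution = ∀' ∀' (x₁ ≐ x₀ ⊕ 𝟏 ⇒ x₂ ^ 3 ⊗ x₂ ^ 3 ≤ x₁ ⇒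
  ∃' SquareRoot x₂ x₀ ∧ ∃' EighthRoot x₁ x₀ ∨ ∃' EighthRoot x₂ x₀ ∧ ∃' SquareRoot x₁ x₀ ⇒ ⊥)

primes-divide-1⊗ : ⊢⟨ 2 ⟩ PrimesDivide x₁ x₀ ⇒ PrimesDivide (𝟏 ⊗ x₁) x₀
primes-divide-1⊗ = ⇒I (∀I (⇒I (⇒I (∃E h0 (∀E h3 x₁ ∙ h2 ∙ divides x₀ (linear-≐ h0 refl))))))

abc⇒no-large-solution : ⊢⟨ 1 ⟩ ABC ⇒ NoLargeSolution
abc⇒no-large-solution = ⇒I (∀I (∀I (⇒I (⇒I (⇒I
  -- The conjecture is applied to 1 + Y = X, where coprimality is automatic.
  (∃E (∀E (∀E (∀E h3 𝟏) x₀) x₁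
      ∙ ∧I (use one-coprime (x₀ ∷ [])) (∧I (use one-coprime (x₁ ∷ []))
          (use suc-coprime (x₁ ∷ x₀ ∷ []) ∙ ≐-sym h2))
      ∙ linear-≐ (≐-sym h2) refl)
    (∨E h1
      (∃E (∧E₁ h0) (∃E (∧E₂ h1)
        (use abc-bound (x₅ ∷ x₂ ∷ x₀ ∷ x₁ ∷ x₄ ∷ [])
          ∙ ∧E₁ (∧E₂ h1)
          ∙ linear-≤ 𝟏 (⊕-mono (∧E₁ (∧E₂ h0)) (≤-reflexive (≐-sym h6))) refl
          ∙ linear-≤ 𝟎 (use rad-≤ (x₀ ⊗ x₁ ∷ x₂ ∷ 𝟏 ⊗ x₃ ⊗ x₄ ∷ []) ∙ ∧E₁ h3
              ∙ (use primes-divide-⊗ (x₁ ∷ x₀ ∷ x₄ ∷ 𝟏 ⊗ x₃ ∷ [])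
                ∙ (use primes-divide-1⊗ (x₀ ∷ x₃ ∷ []) ∙ ∧E₂ (∧E₂ h0)) ∙ ∧E₂ (∧E₂ h1))
              ∙ linear-≤ 𝟎 (⊗-mono (∧E₁ h0) (∧E₁ h1)) refl) refl
          ∙ h5 ∙ ∧E₂ h3)))
      (∃E (∧E₁ h0) (∃E (∧E₂ h1)
        (use abc-bound (x₅ ∷ x₂ ∷ x₁ ∷ x₀ ∷ x₄ ∷ [])
          ∙ linear-≤ 𝟏 (⊕-mono (∧E₁ (∧E₂ h0)) (≤-reflexive (≐-sym h6))) refl
          ∙ ∧E₁ (∧E₂ h1)
          ∙ linear-≤ 𝟎 (use rad-≤ (x₀ ⊗ x₁ ∷ x₂ ∷ 𝟏 ⊗ x₃ ⊗ x₄ ∷ []) ∙ ∧E₁ h3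
              ∙ (use primes-divide-⊗ (x₁ ∷ x₀ ∷ x₄ ∷ 𝟏 ⊗ x₃ ∷ [])
                ∙ (use primes-divide-1⊗ (x₀ ∷ x₃ ∷ []) ∙ ∧E₂ (∧E₂ h0)) ∙ ∧E₂ (∧E₂ h1))
              ∙ linear-≤ 𝟎 (⊗-mono (∧E₁ h0) (∧E₁ h1)) refl) refl
          ∙ h5 ∙ ∧E₂ h3))))))))))

-- Working in S + Exp′

-- As e(s,t) is not an L-term, `Power` is lifted with variables and the terms are substituted
-- afterwards.
PowerE : (s t : Term Lᵉ n) → Formula Lᵉ n
PowerE s t = sub (lookup (e s t ∷ t ∷ s ∷ [])) (lift (Power x₂ x₁ x₀))

-- The free variable is a lower bound for both e(x,y) and, in A, the exponent y.
PowerOrLarge : Formula Lᵉ 1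
PowerOrLarge = ∀' ∀' (𝟏 < x₁ ⇒ A x₀ ⇒
  PowerE x₁ x₀ ∨ (x₂ ≤ e x₁ x₀) ∧ ∃' (A x₀ ∧ (x₁ ≐ x₀ ⊕ x₃)))

-- Written as repeated successors so that adding 8 to the numeral of N is definitionally the numeral
-- of `8 + N`.
_+8 : Term ℓ n → Term ℓ n
t +8 = t ⊕ 𝟏 ⊕ 𝟏 ⊕ 𝟏 ⊕ 𝟏 ⊕ 𝟏 ⊕ 𝟏 ⊕ 𝟏 ⊕ 𝟏

-- The premise is the shape that `_ᴬ` gives to an existential formula; the witness comes with its
-- membership in A.
∃ᴬE : ∀ {T : Theory Lᵉ c} {Γ : List (Formula Lᵉ n)} {φ ψ} →
      T ⨾ Γ ⊢ ¬ (∀' (A x₀ ⇒ ¬ φ)) → T ⨾ φ ∷ A x₀ ∷ map weaken Γ ⊢ weaken ψ → T ⨾ Γ ⊢ ψ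
∃ᴬE p q = raa (wk p ∙ ∀I (⇒I (⇒I (h2 ∙ monotone (∷⁺ʳ _ (∷⁺ʳ _ there)) q))))

module _ {S : Theory L c} (S⊇IΣ₁ : S Extends IΣ₁) where

  private
    variable
      Γᵉ : List (Formula Lᵉ n)

  infix 0 ⊢ᵉ⟨_⟩_

  ⊢ᵉ⟨_⟩_ : ∀ n → Formula Lᵉ n → Set _
  ⊢ᵉ⟨ n ⟩ φ = (S +Exp′) ⨾ [] ⊢ φ

  arithmetic : {φ : Formula L m} → ⊢⟨ m ⟩ φ → (ts : Vec (Term Lᵉ n) m) →
               (S +Exp′) ⨾ Γᵉ ⊢ sub (lookup ts) (lift φ)
  arithmetic p ts = instantiate (lookup ts) (lift-derivation (replace-axioms S⊇IΣ₁ p))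

  exp-axiom : ∀ (m : ℕ) {φ : Formula Lᵉ m} → Exp′ (∀* m φ) → (ts : Vec (Term Lᵉ n) m) →
              (S +Exp′) ⨾ Γᵉ ⊢ sub (lookup ts) φ
  exp-axiom m a ts = axiom m (exp′ a) ts

  A-1 : (S +Exp′) ⨾ Γᵉ ⊢ A 𝟏
  A-1 = exp-axiom 0 A-one []

  A-⊕ : (S +Exp′) ⨾ Γᵉ ⊢ A s → (S +Exp′) ⨾ Γᵉ ⊢ A t → (S +Exp′) ⨾ Γᵉ ⊢ A (s ⊕ t)
  A-⊕ {s = s} {t = t} p q = exp-axiom 2 A-+ (t ∷ s ∷ []) ∙ p ∙ q

  A-numeral : ∀ k → (S +Exp′) ⨾ Γᵉ ⊢ A (liftᵗ (numeral k))
  A-numeral zero    = exp-axiom 0 A-zero []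
  A-numeral (suc k) = A-⊕ (A-numeral k) A-1

  e-cong : ∀ s → (S +Exp′) ⨾ Γᵉ ⊢ t ≐ t′ → (S +Exp′) ⨾ Γᵉ ⊢ e s t ≐ e s t′
  e-cong {t = t} {t′ = t′} s p =
    subst (λ u → _ ⨾ _ ⊢ e s t ≐ e u t′) (subᵗ-inst-↑ t′ s)
      (subst (λ u → _ ⨾ _ ⊢ e u t ≐ e _ t′) (subᵗ-inst-↑ t s) (congruence (e (s ↑ 1) x₀) p))

  e-zero : ∀ s → (S +Exp′) ⨾ Γᵉ ⊢ e s 𝟎 ≐ 𝟏
  e-zero s = ⇔₁ (exp-axiom 2 e1 (𝟎 ∷ s ∷ []) ∙ A-numeral 0) (∨I₂ (≐I 𝟎))

  e-⊕ : ∀ s → (S +Exp′) ⨾ Γᵉ ⊢ A t → (S +Exp′) ⨾ Γᵉ ⊢ A u →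
        (S +Exp′) ⨾ Γᵉ ⊢ e s (t ⊕ u) ≐ e s t ⊗ e s u
  e-⊕ {t = t} {u = u} s p q = exp-axiom 3 e4 (u ∷ t ∷ s ∷ []) ∙ p ∙ q

  e-suc : ∀ s → (S +Exp′) ⨾ Γᵉ ⊢ A t → (S +Exp′) ⨾ Γᵉ ⊢ e s (t ⊕ 𝟏) ≐ e s t ⊗ s
  e-suc s p = ≐-trans (e-⊕ s p A-1) (⊗-cong (≐I _) (exp-axiom 1 e3 (s ∷ [])))

  2≤ : (S +Exp′) ⨾ Γᵉ ⊢ 𝟏 < s → (S +Exp′) ⨾ Γᵉ ⊢ 𝟏 ⊕ 𝟏 ≤ s
  2≤ {s = s} p = arithmetic {φ = 𝟏 < x₀ ⇒ 𝟏 ⊕ 𝟏 ≤ x₀} (⇒I (<⇒⊕1≤ h0)) (s ∷ []) ∙ p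

  1≤e : (S +Exp′) ⨾ Γᵉ ⊢ 𝟏 ≤ s → (S +Exp′) ⨾ Γᵉ ⊢ A t → (S +Exp′) ⨾ Γᵉ ⊢ 𝟏 ≤ e s t
  1≤e {s = s} {t = t} p q = arithmetic {φ = ¬ (x₀ ≐ 𝟎) ⇒ 𝟏 ≤ x₀} (⇒I (≢0⇒1≤ h0)) (e s t ∷ [])
    ∙ (exp-axiom 2 e2 (t ∷ s ∷ []) ∙ q
      ∙ (arithmetic {φ = 𝟏 ≤ x₀ ⇒ x₀ ≐ 𝟎 ⇒ ⊥}
          (⇒I (⇒I (absurd-≤ 𝟎 (⊕-mono h1 (≤-reflexive h0)) refl))) (s ∷ []) ∙ p))

  power-e-zero : ∀ s → (S +Exp′) ⨾ Γᵉ ⊢ PowerE s 𝟎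
  power-e-zero s = arithmetic power-cong (e s 𝟎 ∷ 𝟏 ∷ 𝟎 ∷ 𝟎 ∷ s ∷ [])
    ∙ ≐I 𝟎 ∙ ≐-sym (e-zero s) ∙ arithmetic power-zero (s ∷ [])

  power-e-suc : (S +Exp′) ⨾ Γᵉ ⊢ 𝟏 ≤ s → (S +Exp′) ⨾ Γᵉ ⊢ A t →
                (S +Exp′) ⨾ Γᵉ ⊢ PowerE s t → (S +Exp′) ⨾ Γᵉ ⊢ PowerE s (t ⊕ 𝟏)
  power-e-suc {s = s} {t = t} p q r =
    arithmetic power-cong (e s (t ⊕ 𝟏) ∷ e s t ⊗ s ∷ t ⊕ 𝟏 ∷ t ⊕ 𝟏 ∷ s ∷ [])
      ∙ ≐I _ ∙ ≐-sym (e-suc s q) ∙ (arithmetic power-suc (e s t ∷ t ∷ s ∷ []) ∙ p ∙ r)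

  power-or-large-zero : (S +Exp′) ⊢ sub (lookup (𝟎 ∷ [])) PowerOrLarge
  power-or-large-zero = ∀I (∀I (⇒I (⇒I (∨I₂ (∧I
    (arithmetic {φ = 𝟎 ≤ x₀} (≤-intro x₀ refl) (e x₁ x₀ ∷ []))
    (∃I x₀ (∧I h0 (arithmetic {φ = x₀ ≐ x₀ ⊕ 𝟎} (ring refl) (x₀ ∷ [])))))))))

  -- A nonzero exponent has a predecessor in A because A satisfies Presburger arithmetic. Either
  -- alternative for the predecessor passes to the exponent itself, and exponent zero falls under
  -- the first.
  power-or-large-suc : ⊢ᵉ⟨ 1 ⟩
    PowerOrLarge ⇒ sub (lookup (x₀ ⊕ 𝟏 ∷ [])) PowerOrLarge
  power-or-large-suc = ⇒I (∀I (∀I (⇒I (⇒I (by-cases (x₀ ≐ 𝟎)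
    (∨I₁ (≐E (PowerE x₂ x₀) (≐-sym h0) (power-e-zero x₁)))
    (∃ᴬE (exp-axiom 1 (A-Pr 0-or-suc) (x₀ ∷ []) ∙ h1 ∙ h0)
      (∨E (∀E (∀E h5 x₂) x₀ ∙ h4 ∙ h1)
        (∨I₁ (≐E (PowerE x₃ x₀) (≐-sym h1) (power-e-suc (∧E₁ h5) h2 h0)))
        (∨I₂ (∧I
          -- Since x ≥ 2 and the previous power is at least 1, multiplying by x raises the lower
          -- bound by one.
          (arithmetic {φ = x₃ ≤ x₂ ⇒ 𝟏 ⊕ 𝟏 ≤ x₁ ⇒ 𝟏 ≤ x₂ ⇒ x₀ ≐ x₂ ⊗ x₁ ⇒ x₃ ⊕ 𝟏 ≤ x₀}
            (⇒I (⇒I (⇒I (⇒I (linear-≤ 𝟎 (⊕-mono h3 (⊕-mono h1 (⊕-mono (x₂ ·≤ h2)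
              (≤-reflexive (≐-sym h0))))) refl)))))
            (e x₂ x₁ ∷ x₂ ∷ e x₂ x₀ ∷ x₃ ∷ [])
            ∙ ∧E₁ h0 ∙ 2≤ h5 ∙ 1≤e (∧E₁ h5) h2 ∙ ≐-trans (e-cong x₂ h1) (e-suc x₂ h2))
          (∃E (∧E₂ h0) (∃I x₀ (∧I (∧E₁ h0)
            (arithmetic {φ = x₂ ≐ x₁ ⊕ 𝟏 ⇒ x₁ ≐ x₀ ⊕ x₃ ⇒ x₂ ≐ x₀ ⊕ (x₃ ⊕ 𝟏)}
              (⇒I (⇒I (linear-≐ (⊕-cong h1 h0) refl)))
              (x₀ ∷ x₁ ∷ x₂ ∷ x₄ ∷ []) ∙ h2 ∙ ∧E₂ h0)))))))))))))

  -- The recursion runs over the natural number `k` outside the theory, since the formula contains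
  -- `e` and IΣ₁ gives no induction for it.
  power-or-large : ∀ k → (S +Exp′) ⊢ sub (lookup (liftᵗ (numeral k) ∷ [])) PowerOrLarge
  power-or-large zero    = power-or-large-zero
  power-or-large (suc k) =
    instantiate {φ = PowerOrLarge ⇒ sub (lookup (x₀ ⊕ 𝟏 ∷ [])) PowerOrLarge}
      (lookup (liftᵗ (numeral k) ∷ [])) power-or-large-suc ∙ power-or-large k

  -- Only the summand w of the exponent w + 2 (k + 1) is divided by Presburger arithmetic. The
  -- offset k + 1 that remains keeps the halved exponent positive and leaves room for further
  -- halvings.
  halving : ⊢ᵉ⟨ 4 ⟩ 𝟏 ≤ x₃ ⇒ A x₂ ⇒ A x₁ ⇒ x₀ ≐ x₂ ⊕ ((x₁ ⊕ 𝟏) ⊕ (x₁ ⊕ 𝟏)) ⇒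
    ∃' (A x₀ ∧ Root (e x₄ x₁) (e x₄ (x₀ ⊕ (x₂ ⊕ 𝟏))))
  halving = ⇒I (⇒I (⇒I (⇒I (∃ᴬE (exp-axiom 1 (A-Pr (division 1)) (x₂ ∷ []) ∙ h2)
    (∃I x₀ (∧I h1 (∨E (arithmetic halves (x₀ ∷ x₃ ∷ []) ∙ h0)
      (cut (A-⊕ h2 (A-⊕ h4 A-1))
        (arithmetic root-even (e x₄ (x₀ ⊕ (x₂ ⊕ 𝟏)) ∷ e x₄ x₁ ∷ [])
          ∙ 1≤e h7 h0
          ∙ ≐-trans (e-cong x₄
              (arithmetic {φ = x₀ ≐ x₂ ⊕ ((x₁ ⊕ 𝟏) ⊕ (x₁ ⊕ 𝟏)) ⇒ x₂ ≐ x₃ ⊕ x₃ ⇒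
                  x₀ ≐ (x₃ ⊕ (x₁ ⊕ 𝟏)) ⊕ (x₃ ⊕ (x₁ ⊕ 𝟏))}
                (⇒I (⇒I (linear-≐ (⊕-cong h1 h0) refl))) (x₁ ∷ x₂ ∷ x₃ ∷ x₀ ∷ []) ∙ h4 ∙ h1))
              (e-⊕ x₄ h0 h0)))
      (cut (A-⊕ h2 (A-⊕ h4 A-1))
        -- For w = 2 q + 1 the surplus factor x is also a factor of the root, because e(x, q + k +
        -- 1) = e(x, q + k) x.
        (arithmetic root-odd (x₄ ∷ e x₄ (x₀ ⊕ x₂) ∷ e x₄ (x₀ ⊕ (x₂ ⊕ 𝟏)) ∷ e x₄ x₁ ∷ [])
          ∙ 1≤e h7 h0
          ∙ h7
          ∙ ≐-trans (e-cong x₄ (arithmetic {φ = x₁ ⊕ (x₀ ⊕ 𝟏) ≐ (x₁ ⊕ x₀) ⊕ 𝟏} (ring refl) (x₂ ∷ x₀ ∷ [])))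
              (e-suc x₄ (A-⊕ h3 h5))
          ∙ ≐-trans (e-cong x₄
              (arithmetic {φ = x₀ ≐ x₂ ⊕ ((x₁ ⊕ 𝟏) ⊕ (x₁ ⊕ 𝟏)) ⇒ x₂ ≐ x₃ ⊕ x₃ ⊕ 𝟏 ⇒
                  x₀ ≐ ((x₃ ⊕ (x₁ ⊕ 𝟏)) ⊕ (x₃ ⊕ (x₁ ⊕ 𝟏))) ⊕ 𝟏}
                (⇒I (⇒I (linear-≐ (⊕-cong h1 h0) refl))) (x₁ ∷ x₂ ∷ x₃ ∷ x₀ ∷ []) ∙ h4 ∙ h1))
              (≐-trans (e-suc x₄ (A-⊕ h0 h0)) (⊗-cong (e-⊕ x₄ h0 h0) (≐I x₄))))))))))))
    where
    halves : ⊢⟨ 2 ⟩ (2 · x₀ ≤ x₁) ∧ (x₁ < 2 · (x₀ ⊕ 𝟏)) ⇒ x₁ ≐ x₀ ⊕ x₀ ∨ x₁ ≐ x₀ ⊕ x₀ ⊕ 𝟏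
    halves = ⇒I (compare x₁ (x₀ ⊕ x₀)
      (∨I₁ (≤-antisym h0 (linear-≤ 𝟎 (∧E₁ h1) refl)))
      (∨I₂ (≤-antisym (linear-≤ 𝟎 (<⇒⊕1≤ (∧E₂ h1)) refl) h0)))

  -- An exponent above 1 has two successive predecessors in A, so it has the form w + 2 (0 + 1) that
  -- `halving` asks for.
  square-root-e : ⊢ᵉ⟨ 2 ⟩ 𝟏 ≤ x₁ ⇒ A x₀ ⇒ 𝟏 < x₀ ⇒ ∃' SquareRoot (e x₂ x₁) x₀
  square-root-e = ⇒I (⇒I (⇒I
    (∃ᴬE (exp-axiom 1 (A-Pr 0-or-suc) (x₀ ∷ []) ∙ h1 ∙ (arithmetic {φ = 𝟏 < x₀ ⇒ x₀ ≐ 𝟎 ⇒ ⊥}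
        (⇒I (⇒I (absurd-≤ 𝟏 (⊕-mono (<⇒⊕1≤ h1) (≤-reflexive h0)) refl))) (x₀ ∷ []) ∙ h0))
      (∃ᴬE (exp-axiom 1 (A-Pr 0-or-suc) (x₀ ∷ []) ∙ h1
          ∙ (arithmetic {φ = 𝟏 < x₁ ⇒ x₁ ≐ x₀ ⊕ 𝟏 ⇒ x₀ ≐ 𝟎 ⇒ ⊥}
              (⇒I (⇒I (⇒I (absurd-≤ 𝟎 (⊕-mono (<⇒⊕1≤ h2)
                (⊕-mono (≤-reflexive h1) (≤-reflexive h0))) refl)))) (x₀ ∷ x₁ ∷ []) ∙ h2 ∙ h0))
        (∃E (instantiate (lookup (x₂ ∷ 𝟎 ∷ x₀ ∷ x₃ ∷ [])) halving ∙ h6 ∙ h1 ∙ A-numeral 0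
            ∙ (arithmetic {φ = x₂ ≐ x₁ ⊕ 𝟏 ⇒ x₁ ≐ x₀ ⊕ 𝟏 ⇒ x₂ ≐ x₀ ⊕ ((𝟎 ⊕ 𝟏) ⊕ (𝟎 ⊕ 𝟏))}
                (⇒I (⇒I (linear-≐ (⊕-cong h1 h0) refl))) (x₀ ∷ x₁ ∷ x₂ ∷ []) ∙ h2 ∙ h0))
          (∃I (e x₄ (x₀ ⊕ (𝟎 ⊕ 𝟏)))
            (arithmetic root⇒square-root (e x₄ (x₀ ⊕ (𝟎 ⊕ 𝟏)) ∷ e x₄ x₃ ∷ []) ∙ ∧E₂ h0)))))))

  eighth-root-e : ⊢ᵉ⟨ 3 ⟩ 𝟏 ≤ x₁ ⇒ A x₂ ⇒ ∃' (A x₀ ∧ (x₁ ≐ x₀ ⊕ x₃ +8)) ⇒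
    ∃' EighthRoot (e x₂ x₁) x₀
  eighth-root-e = ⇒I (⇒I (⇒I (∃E h0
    -- The offsets 3, 1 and 0 come from 8 = 2 · 4, 4 = 2 · 2 and 2 = 2 · 1, each half being the
    -- `k + 1` of `halving`.
    (∃E (instantiate (lookup (x₁ ∷ numeral 3 ∷ x₀ ⊕ x₃ ∷ x₂ ∷ [])) halving
        ∙ h3 ∙ A-⊕ (∧E₁ h0) h2 ∙ A-numeral 3
        ∙ (arithmetic {φ = x₂ ≐ x₁ ⊕ x₀ +8 ⇒
              x₂ ≐ (x₁ ⊕ x₀) ⊕ ((numeral 3 ⊕ 𝟏) ⊕ (numeral 3 ⊕ 𝟏))}
            (⇒I (linear-≐ h0 refl)) (x₃ ∷ x₀ ∷ x₁ ∷ []) ∙ ∧E₂ h0))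
      (∃E (instantiate (lookup (x₀ ⊕ (numeral 3 ⊕ 𝟏) ∷ numeral 1 ∷ x₀ ∷ x₃ ∷ [])) halving
          ∙ h4 ∙ ∧E₁ h0 ∙ A-numeral 1
          ∙ arithmetic {φ = x₀ ⊕ (numeral 3 ⊕ 𝟏) ≐ x₀ ⊕ ((numeral 1 ⊕ 𝟏) ⊕ (numeral 1 ⊕ 𝟏))}
              (ring refl) (x₀ ∷ []))
        (∃E (instantiate (lookup (x₀ ⊕ (numeral 1 ⊕ 𝟏) ∷ 𝟎 ∷ x₀ ∷ x₄ ∷ [])) halving
            ∙ h5 ∙ ∧E₁ h0 ∙ A-numeral 0
            ∙ arithmetic {φ = x₀ ⊕ (numeral 1 ⊕ 𝟏) ≐ x₀ ⊕ ((𝟎 ⊕ 𝟏) ⊕ (𝟎 ⊕ 𝟏))}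
                (ring refl) (x₀ ∷ []))
          (∃I (e x₅ (x₀ ⊕ (𝟎 ⊕ 𝟏)))
            (arithmetic eighth-root (e x₅ (x₀ ⊕ (𝟎 ⊕ 𝟏)) ∷ e x₅ (x₁ ⊕ (numeral 1 ⊕ 𝟏)) ∷
                e x₅ (x₂ ⊕ (numeral 3 ⊕ 𝟏)) ∷ e x₅ x₄ ∷ [])
              ∙ ∧E₂ h2 ∙ ∧E₂ h1 ∙ ∧E₂ h0))))))))

  -- The single threshold N + 8 serves two ends: 8 allows three halvings of the exponent, and N ≥ K⁶
  -- makes the power large enough for the abc estimate.
  catalan-from-bound : S ⊢ Catalan → ⊢ᵉ⟨ 2 ⟩
    sub (lookup (x₁ ∷ [])) (lift NoLargeSolution) ⇒ x₁ ^ 3 ⊗ x₁ ^ 3 ≤ x₀ ⇒ A x₀ ⇒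
    sub (lookup (x₀ +8 ∷ [])) PowerOrLarge ⇒ weakenₛ Catalanᵉ
  catalan-from-bound catalan = ⇒I (⇒I (⇒I (⇒I (∀I (∀I (∀I (∀I (⇒I (⇒I (⇒I
    (∨E (∀E (∀E h3 x₃) x₁ ∙ ∧E₁ h1 ∙ ∧E₁ h2)
      (∨E (∀E (∀E h4 x₂) x₀ ∙ ∧E₁ (∧E₂ h2) ∙ ∧E₂ h3)
        -- Both powers are coded, so Catalan's conjecture in S applies to them.
        (instantiate (lookup (x₀ ∷ x₁ ∷ x₂ ∷ x₃ ∷ [])) (lift-derivation (unclose 4 catalan))
          ∙ h3 ∙ ∃I (e x₃ x₁) (∃I (e x₂ x₀) (∧I
            (arithmetic power-exp (e x₃ x₁ ∷ x₁ ∷ x₃ ∷ []) ∙ h1)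
            (∧I (arithmetic power-exp (e x₂ x₀ ∷ x₀ ∷ x₂ ∷ []) ∙ h0) h2))))
        -- Here b is large, so Y has an eighth root, while a > 1 still gives a square root of X.
        (⊥E (∀E (∀E h8 (e x₃ x₁)) (e x₂ x₀) ∙ h2
          ∙ (arithmetic {φ = x₃ ≤ x₂ ⇒ x₂ +8 ≤ x₁ ⇒ x₀ ≐ x₁ ⊕ 𝟏 ⇒ x₃ ≤ x₀}
              (⇒I (⇒I (⇒I (linear-≤ (numeral 9) (⊕-mono h2 (⊕-mono h1 (≤-reflexive (≐-sym h0)))) refl))))
              (e x₃ x₁ ∷ e x₂ x₀ ∷ x₄ ∷ x₅ ^ 3 ⊗ x₅ ^ 3 ∷ []) ∙ h7 ∙ ∧E₁ h0 ∙ h2)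
          ∙ ∨I₁ (∧I
              (instantiate (lookup (x₁ ∷ x₃ ∷ [])) square-root-e
                ∙ ∧E₁ (∧E₁ h3) ∙ ∧E₁ h4 ∙ ∧E₁ (∧E₂ (∧E₂ h3)))
              (instantiate (lookup (x₀ ∷ x₂ ∷ x₄ ∷ [])) eighth-root-e
                ∙ ∧E₁ (∧E₁ (∧E₂ h3)) ∙ h6 ∙ ∧E₂ h0)))))
      -- Here a is large and the roles of X and Y are exchanged; nothing is assumed of b beyond b >
      -- 1.
      (⊥E (∀E (∀E h7 (e x₃ x₁)) (e x₂ x₀) ∙ h1
        ∙ (arithmetic {φ = x₂ ≤ x₁ ⇒ x₁ +8 ≤ x₀ ⇒ x₂ ≤ x₀}
            (⇒I (⇒I (linear-≤ (numeral 8) (⊕-mono h1 h0) refl)))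
            (e x₃ x₁ ∷ x₄ ∷ x₅ ^ 3 ⊗ x₅ ^ 3 ∷ []) ∙ h6 ∙ ∧E₁ h0)
        ∙ ∨I₂ (∧I
            (instantiate (lookup (x₁ ∷ x₃ ∷ x₄ ∷ [])) eighth-root-e
              ∙ ∧E₁ (∧E₁ h2) ∙ h5 ∙ ∧E₂ h0)
            (instantiate (lookup (x₀ ∷ x₂ ∷ [])) square-root-e
              ∙ ∧E₁ (∧E₁ (∧E₂ h2)) ∙ ∧E₂ h3 ∙ ∧E₂ (∧E₂ (∧E₂ h2)))))))))))))))))

-- Closed terms and the constant of the abc conjecture

numeral-⊕ : ∀ m n → IΣ₁ ⨾ Γ ⊢ numeral m ⊕ numeral n ≐ numeral (n + m)
numeral-⊕ m zero    = ⊕-identityʳ _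
numeral-⊕ m (suc n) = ≐-trans (⊕-sucʳ _ _) (⊕-cong (numeral-⊕ m n) (≐I 𝟏))

numeral-⊗ : ∀ m n → IΣ₁ ⨾ Γ ⊢ numeral m ⊗ numeral n ≐ numeral (n * m)
numeral-⊗ m zero    = ⊗-zeroʳ _
numeral-⊗ m (suc n) = ≐-trans (⊗-sucʳ _ _) (≐-trans (⊕-cong (numeral-⊗ m n) (≐I _)) (numeral-⊕ (n * m) m))

-- The threshold K⁶ has to become a numeral, because `power-or-large` recurses on the natural number
-- behind it.
closed-term-value : ∀ (t : Term L 0) → ∃ λ k → IΣ₁ ⨾ [] ⊢ t ≐ numeral k
closed-term-value 𝟎 = 0 , ≐I 𝟎
closed-term-value 𝟏 = 1 , ≐-sym (⊕-identityˡ 𝟏)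
closed-term-value (s ⊕ t) with closed-term-value s | closed-term-value t
... | j , p | k , q = k + j , ≐-trans (⊕-cong p q) (numeral-⊕ j k)
closed-term-value (s ⊗ t) with closed-term-value s | closed-term-value t
... | j , p | k , q = k * j , ≐-trans (⊗-cong p q) (numeral-⊗ j k)

numeral-↑ : ∀ k → numeral {n = n} k ↑ 1 ≡ numeral {ℓ} k
numeral-↑ zero    = refl
numeral-↑ (suc k) = cong (_⊕ 𝟏) (numeral-↑ k)

-- Substitution under four binders shifts the numeral of K four times. A shift fixes a numeral only
-- by induction on K, so the two sentences do not agree by computation.
abc-constant : ∀ K → abc K ≡ sub (lookup (numeral K ∷ [])) ABC
abc-constant K = cong body (sym (trans (cong (λ t → ((t ↑ 1) ↑ 1) ↑ 1) (numeral-↑ K))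
  (trans (cong (λ t → (t ↑ 1) ↑ 1) (numeral-↑ K)) (trans (cong (_↑ 1) (numeral-↑ K)) (numeral-↑ K)))))
  where
  body : Term L 4 → Sentence L
  body k = ∀' ∀' ∀'
    ( Coprime x₂ x₁ ∧ Coprime x₂ x₀ ∧ Coprime x₁ x₀ ⇒ x₂ ⊕ x₁ ≐ x₀ ⇒
      ∃' (Rad (x₃ ⊗ x₂ ⊗ x₁) x₀ ∧ (x₁ ^ 3 < k ^ 3 ⊗ x₀ ^ 4)))

theorem5p2 : ∀ {c : Level} (S : Theory L c) →
    S Extends IΣ₁ →
    (∃ λ (K : ℕ) → S ⊢ abc K) →
    S ⊢ Catalan →
    (S +Exp′) ⊢ Catalanᵉ
theorem5p2 S S⊇IΣ₁ (K , abcK) catalan with closed-term-value (numeral K ^ 3 ⊗ numeral K ^ 3)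
... | N , value = instantiate {φ = sub (lookup (x₁ ∷ [])) (lift NoLargeSolution) ⇒ x₁ ^ 3 ⊗ x₁ ^ 3 ≤ x₀ ⇒ A x₀ ⇒
      sub (lookup (x₀ +8 ∷ [])) PowerOrLarge ⇒ weakenₛ Catalanᵉ}
      (lookup (liftᵗ (numeral N) ∷ liftᵗ (numeral K) ∷ [])) (catalan-from-bound S⊇IΣ₁ catalan)
    ∙ no-large-solution
    ∙ lift-derivation (replace-axioms S⊇IΣ₁ (≤-reflexive value))
    ∙ A-numeral S⊇IΣ₁ N
    ∙ power-or-large S⊇IΣ₁ (8 + N)
  where
  no-large-solution : (S +Exp′) ⊢ sub (lookup (liftᵗ (numeral K) ∷ [])) (lift NoLargeSolution)
  no-large-solution = subst ((S +Exp′) ⊢_) (lift-sub {σ = lookup (numeral K ∷ [])} {τ = lookup (liftᵗ (numeral K) ∷ [])}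
      (λ { zero → refl }) NoLargeSolution)
    (lift-derivation
      (instantiate {φ = ABC ⇒ NoLargeSolution} (lookup (numeral K ∷ [])) (replace-axioms S⊇IΣ₁ abc⇒no-large-solution)
        ∙ subst (S ⊢_) (abc-constant K) abcK))
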